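{- Let $r\ge 3$, let $\theta=\alpha_1+\cdots+\alpha_r$ be the highest root of $\mathfrak{sl}_{r+1}(\mathbb{C})$, fix $i\in[r-2]$ and let $j\in[r-i-1]$. Then \[ m_q(\theta,\alpha_{1,i}+\alpha_{i+j+1,r})=q^j-q^{j-1}. \]
   Context: Notation: $[n]=\{1,\dots,n\}$. In $\mathfrak{sl}_{r+1}(\mathbb{C})$, with $e_1,\dots,e_{r+1}$ the standard basis of $\mathbb{R}^{r+1}$, the simple roots are $\alpha_i=e_i-e_{i+1}$ ($i\in[r]$), the positive roots are $\alpha_{i,j}=\alpha_i+\cdots+\alpha_j$ for $1\le i\le j\le r$, the highest root is $\theta=\alpha_{1,r}$, and $\rho$ is half the sum of the positive roots. The Weyl group $W\cong\mathfrak{S}_{r+1}$ is generated by the simple reflections $s_i$ (reflection through the hyperplane orthogonal to $\alpha_i$), and $\ell(\sigma)$ is the length of $\sigma\in W$. The $q$-analog of Kostant's partition function is $\wp_q(\xi)=\sum_{k\ge0}c_kq^k$, where $c_k$ is the number of ways to write $\xi$ as a sum of exactly $k$ positive roots (unordered, with repetition allowed); in particular $\wp_q(0)=1$ and $\wp_q(\xi)=0$ if $\xi$ is not a nonnegative integral combination of positive roots. The $q$-analog of Kostant's weight multiplicity formula is $m_q(\lambda,\mu)=\sum_{\sigma\in W}(-1)^{\ell(\sigma)}\wp_q(\sigma(\lambda+\rho)-\rho-\mu)$. -}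

module Defs where

open import Data.Nat using (ℕ; zero; suc; _∸_) renaming (_+_ to _+ℕ_; _≡ᵇ_ to _==_; _<ᵇ_ to _<ᵇ_)
open import Data.Bool using (Bool; true; false; if_then_else_; _∧_; not)
open import Data.Fin using (Fin; toℕ) renaming (zero to fzero; suc to fsuc)
open import Data.List using (List; []; _∷_; _++_; map; concatMap; filter; foldr; allFin; upTo; length)
open import Data.Integer using (ℤ) renaming (_+_ to _+ℤ_; _*_ to _*ℤ_; -_ to -ℤ_; +_ to +ℤ_)
open import Data.Rational using (ℚ; 0ℚ; 1ℚ; ½) renaming (_+_ to _+ℚ_; _-_ to _-ℚ_; _*_ to _*ℚ_)
open import Data.Rational.Properties using () renaming (_≟_ to _≟ℚ_)
open import Relation.Nullary.Decidable using (⌊_⌋)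
open import Data.Fin.Properties using () renaming (_≟_ to _≟F_)
open import Data.Product using (_×_; _,_; proj₁; proj₂)

all : ∀ {A : Set} → (A → Bool) → List A → Bool
all p []       = true
all p (x ∷ xs) = p x ∧ all p xs

-- Weights of sl_{r+1}: vectors in ℚ^{r+1} (coordinates w.r.t. e_1..e_{r+1};
-- coordinate a : Fin (suc r) is the coefficient of e_{toℕ a + 1}).

Wt : ℕ → Set
Wt r = Fin (suc r) → ℚ

infixl 6 _⊕_ _⊖_
_⊕_ : ∀ {r} → Wt r → Wt r → Wt r
(x ⊕ y) a = x a +ℚ y a

_⊖_ : ∀ {r} → Wt r → Wt r → Wt r
(x ⊖ y) a = x a -ℚ y a

scale : ∀ {r} → ℚ → Wt r → Wt r
scale c x a = c *ℚ x a

zeroW : ∀ {r} → Wt r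
zeroW _ = 0ℚ

sumW : ∀ {r} → List (Wt r) → Wt r
sumW = foldr _⊕_ zeroW

isZeroW : ∀ {r} → Wt r → Bool
isZeroW {r} x = all (λ a → ⌊ x a ≟ℚ 0ℚ ⌋) (allFin (suc r))

-- standard basis vector e_k (1-based index k; zero vector if k ∉ [r+1])
e : ∀ {r} → ℕ → Wt r
e k a = if (toℕ a +ℕ 1) == k then 1ℚ else 0ℚ

α : ∀ {r} → ℕ → Wt r
α k = e k ⊖ e (suc k)

-- [i, j] = list i, i+1, ..., j  (empty if j < i)
range : ℕ → ℕ → List ℕ
range i j = map (λ t → i +ℕ t) (upTo (suc j ∸ i))

αr : ∀ {r} → ℕ → ℕ → Wt r
αr i j = sumW (map α (range i j))

posRoots : (r : ℕ) → List (Wt r)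
posRoots r = concatMap (λ i → map (λ j → αr i j) (range i r)) (range 1 r)

θ : (r : ℕ) → Wt r
θ r = αr 1 r

ρ : (r : ℕ) → Wt r
ρ r = scale ½ (sumW (posRoots r))

-- Kostant's q-partition function.
-- ways βs k ξ = number of multisets of exactly k elements of the list βs
-- (with repetition) whose sum is ξ: either no further copy of the head β
-- is used, or one more copy of β is used.

ways : ∀ {r} → List (Wt r) → ℕ → Wt r → ℕ
ways []       zero    ξ = if isZeroW ξ then 1 else 0
ways []       (suc k) ξ = 0
ways (β ∷ βs) zero    ξ = ways βs zero ξ
ways (β ∷ βs) (suc k) ξ = ways βs (suc k) ξ +ℕ ways (β ∷ βs) k (ξ ⊖ β)

-- ℘_q(ξ) as a polynomial in q, given by its coefficient function:
-- ℘q r ξ k = c_k = coefficient of q^k.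
℘q : (r : ℕ) → Wt r → ℕ → ℕ
℘q r ξ k = ways (posRoots r) k ξ

-- Weyl group W ≅ 𝔖_{r+1}, acting by permuting coordinates.

allFuns : (m n : ℕ) → List (Fin m → Fin n)
allFuns zero    n = (λ ()) ∷ []
allFuns (suc m) n =
  concatMap (λ b → map (λ f → λ { fzero → b ; (fsuc a) → f a }) (allFuns m n)) (allFin n)

isInjective : ∀ {n} → (Fin n → Fin n) → Bool
isInjective {n} σ =
  all (λ a → all (λ b → ⌊ a ≟F b ⌋ ∨' not ⌊ σ a ≟F σ b ⌋ ) (allFin n)) (allFin n)
  where
  _∨'_ : Bool → Bool → Bool
  true  ∨' _ = true
  false ∨' b = b

-- W, listed as the permutations of {1,…,r+1} (each exactly once)
Weyl : (r : ℕ) → List (Fin (suc r) → Fin (suc r))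
Weyl r = filter (λ σ → isInjective σ Data.Bool.≟ true) (allFuns (suc r) (suc r))
  where import Data.Bool

-- action: σ · (Σ_a x_a e_a) = Σ_a x_a e_{σ(a)}
act : ∀ {r} → (Fin (suc r) → Fin (suc r)) → Wt r → Wt r
act {r} σ x b = foldr _+ℚ_ 0ℚ (map (λ a → if ⌊ σ a ≟F b ⌋ then x a else 0ℚ) (allFin (suc r)))

len : ∀ {r} → (Fin (suc r) → Fin (suc r)) → ℕ
len {r} σ = length (filter (λ p → isInv p Data.Bool.≟ true)
                   (concatMap (λ a → map (λ b → (a , b)) (allFin (suc r))) (allFin (suc r))))
  where
  import Data.Bool
  isInv : Fin (suc r) × Fin (suc r) → Bool
  isInv (a , b) = (toℕ a <ᵇ toℕ b) ∧ (toℕ (σ b) <ᵇ toℕ (σ a))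

sgn : ℕ → ℤ
sgn zero          = +ℤ 1
sgn (suc zero)    = -ℤ (+ℤ 1)
sgn (suc (suc n)) = sgn n

sumℤ : List ℤ → ℤ
sumℤ = foldr _+ℤ_ (+ℤ 0)

-- q-analog of Kostant's weight multiplicity formula, as coefficient function:
-- mq r λ μ k = coefficient of q^k in
--   Σ_{σ∈W} (-1)^{ℓ(σ)} ℘_q(σ(λ+ρ) - ρ - μ).

mq : (r : ℕ) → Wt r → Wt r → ℕ → ℤ
mq r λ' μ k =
  sumℤ (map (λ σ → sgn (len σ) *ℤ +ℤ (℘q r (act σ (λ' ⊕ ρ r) ⊖ ρ r ⊖ μ) k)) (Weyl r))

-- coefficient function of the polynomial q^j - q^{j-1}  (for j ≥ 1)
qj-qj-1 : ℕ → ℕ → ℤ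
qj-qj-1 j k = (if k == j then +ℤ 1 else +ℤ 0) +ℤ (if suc k == j then -ℤ (+ℤ 1) else +ℤ 0)

{-# OPTIONS --safe #-}
module Submission where

-- Write v = θ + ρ and M(x) = Σ_σ (−1)^ℓ(σ) ℘_q(σ v − x), so that
-- m_q(θ, μ) = M(ρ + μ). Let M′ be the same sum with the simple root α_c dropped from the partition
-- function. Then M(x) = M′(x) + q M(x + α_c), and M′(s_c x) = −M′(x) because s_c permutes the
-- positive roots other than α_c.
--   * If s_c x = x, then M′(x) = 0 and M(x) = q M(x + α_c).
--   * If s_c x = x + α_c = y, then M(x) = −M(y) + q M(y) + q M(y + α_c).
-- For x = ρ + α_{1,p−1} + α_{t,r} with p + 1 < t the first case (c = p) raises p by one; once
-- p + 1 = t the second case gives y = v. Finally M(v) = 1 and M(v + α_c) = 0, since the pairing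
-- with v is positive on positive roots and maximal at v on the orbit of v. Hence M = q^{j−1}(q − 1).

open import Defs
open import Data.Nat using (ℕ; zero; suc; _≤_; _<_; _+_; _∸_; z≤n; s≤s; _<ᵇ_)
open import Relation.Binary.PropositionalEquality using (_≡_)

import Data.Nat.Properties as ℕP
import Data.Nat.Solver as ℕSolver
import Data.Bool
import Algebra.Properties.Group as GroupProperties
open import Algebra.Structures using (IsCommutativeMonoid)
open import Data.Bool using (Bool; true; false; if_then_else_; _∧_)
open import Data.Empty using (⊥-elim)
open import Data.Fin using (Fin; toℕ; inject₁; punchOut; fromℕ<) renaming (zero to fzero; suc to fsuc)
import Data.Fin.Properties as FP
open import Data.Fin.Properties using () renaming (_≟_ to _≟F_)
open import Data.Integer using (ℤ; 0ℤ; 1ℤ; -1ℤ)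
import Data.Integer as ℤ
import Data.Integer.Properties as ℤP
open import Data.List using (List; []; _∷_; _++_; map; concatMap; filter; foldr; allFin; applyUpTo; length)
open import Data.List.Properties using (map-cong; map-∘; map-++; map-applyUpTo)
open import Data.List.Membership.Propositional using (_∈_; find; lose)
open import Data.List.Membership.Propositional.Properties
  using (∈-map⁺; ∈-map⁻; ∈-concatMap⁺; ∈-concatMap⁻; ∈-upTo⁺; ∈-upTo⁻; ∈-filter⁺; ∈-filter⁻; ∈-allFin)
open import Data.List.Membership.Propositional.Properties.WithK using (unique∧set⇒bag)
open import Data.List.Relation.Binary.BagAndSetEquality using (∼bag⇒↭)
open import Data.List.Relation.Binary.Permutation.Propositional as ↭ using (_↭_)
import Data.List.Relation.Binary.Permutation.Propositional.Properties as Perm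
open import Data.List.Relation.Binary.Pointwise using (Pointwise; []; _∷_)
import Data.List.Relation.Binary.Pointwise as PW
open import Data.List.Relation.Unary.All using (All; []; _∷_)
import Data.List.Relation.Unary.All as All
import Data.List.Relation.Unary.All.Properties as AllP
open import Data.List.Relation.Unary.AllPairs using ([]; _∷_)
import Data.List.Relation.Unary.AllPairs as AllPairs
import Data.List.Relation.Unary.AllPairs.Properties as AllPairsP
open import Data.List.Relation.Unary.Any using (here; there)
open import Data.List.Relation.Unary.Unique.Propositional using (Unique)
import Data.List.Relation.Unary.Unique.Propositional.Properties as Uniq
open import Data.Product using (_×_; _,_; proj₁; proj₂; ∃-syntax)
open import Data.Product.Properties using () renaming (≡-dec to ×-≡-dec)
open import Data.Rational using (ℚ; 0ℚ; 1ℚ; ½)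
import Data.Rational as ℚ
import Data.Rational.Properties as ℚP
import Data.Rational.Solver as ℚSolver
open import Data.Sum using (_⊎_; inj₁; inj₂)
open import Data.Vec.Functional using () renaming (_∷_ to _∷ᶠ_)
open import Function using (_∘_; id; case_of_; mk⇔)
open import Function.Definitions using (Injective)
open import Relation.Binary using (tri<; tri≈; tri>)
open import Relation.Binary.Definitions using (DecidableEquality)
open import Relation.Binary.PropositionalEquality
  using (refl; sym; trans; cong; cong₂; subst; subst₂; _≢_; _≗_; module ≡-Reasoning)
open import Relation.Nullary using (¬_; Dec; yes; no; does)
open import Relation.Nullary.Decidable using (⌊_⌋; dec-true; dec-false; does-⇔; isYes≗does; ¬?)
open ≡-Reasoning

-- Finite sums and products

-- Write the weight as x = ρ + e_1 - e_p + e_t - e_{r+1}. It is fixed by s_p for 1 < p and p + 1 < t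
-- ≤ r because two effects cancel: ρ loses α_p, while e_1 - e_p becomes e_1 - e_{p+1} and gains α_p.
-- At t = p + 1 the other piece e_t - e_{r+1} becomes e_p - e_{r+1} and gains a second α_p, so the
-- reflection lands exactly on ρ + θ. The walk begins at p = i + 1 with t = i + j + 1, which leaves
-- j - 1 steps of the first kind.
--
-- Polynomials in q are coefficient functions, so a factor q is a shift of the index and each
-- identity for M splits into a degree-zero form and a successor form. Weights and permutations are
-- functions, comparable only pointwise: sums over W therefore carry a compatibility hypothesis, and
-- rearrangements of the positive roots are carried out on pairs of numbers, where equality is
-- decidable.

module BigOp {A : Set} {_∙_ : A → A → A} {ε : A} (isCM : IsCommutativeMonoid _≡_ _∙_ ε) where

  open IsCommutativeMonoid isCM using (assoc; comm; identityˡ; identityʳ)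

  ⨁ : {B : Set} → (B → A) → List B → A
  ⨁ f xs = foldr _∙_ ε (map f xs)

  interchange : ∀ a b c d → (a ∙ b) ∙ (c ∙ d) ≡ (a ∙ c) ∙ (b ∙ d)
  interchange a b c d = begin
    (a ∙ b) ∙ (c ∙ d)  ≡⟨ assoc a b (c ∙ d) ⟩
    a ∙ (b ∙ (c ∙ d))  ≡⟨ cong (a ∙_) (assoc b c d) ⟨
    a ∙ ((b ∙ c) ∙ d)  ≡⟨ cong (λ z → a ∙ (z ∙ d)) (comm b c) ⟩
    a ∙ ((c ∙ b) ∙ d)  ≡⟨ cong (a ∙_) (assoc c b d) ⟩
    a ∙ (c ∙ (b ∙ d))  ≡⟨ assoc a c (b ∙ d) ⟨
    (a ∙ c) ∙ (b ∙ d)  ∎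

  module _ {B : Set} where

    ⨁-cong : {f g : B → A} → f ≗ g → ∀ xs → ⨁ f xs ≡ ⨁ g xs
    ⨁-cong f≗g xs = cong (foldr _∙_ ε) (map-cong f≗g xs)

    ⨁-∙ : (f g : B → A) → ∀ xs → ⨁ (λ x → f x ∙ g x) xs ≡ ⨁ f xs ∙ ⨁ g xs
    ⨁-∙ f g []       = sym (identityˡ ε)
    ⨁-∙ f g (x ∷ xs) = trans (cong ((f x ∙ g x) ∙_) (⨁-∙ f g xs)) (interchange _ _ _ _)

    ⨁-++ : (f : B → A) → ∀ xs ys → ⨁ f (xs ++ ys) ≡ ⨁ f xs ∙ ⨁ f ys
    ⨁-++ f []       ys = sym (identityˡ _)
    ⨁-++ f (x ∷ xs) ys = trans (cong (f x ∙_) (⨁-++ f xs ys)) (sym (assoc _ _ _))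

    ⨁-map : {C : Set} (f : B → A) (g : C → B) → ∀ xs → ⨁ f (map g xs) ≡ ⨁ (f ∘ g) xs
    ⨁-map f g xs = cong (foldr _∙_ ε) (sym (map-∘ xs))

    ⨁-concatMap : {C : Set} (f : B → A) (g : C → List B) → ∀ xs →
      ⨁ f (concatMap g xs) ≡ ⨁ (λ x → ⨁ f (g x)) xs
    ⨁-concatMap f g []       = refl
    ⨁-concatMap f g (x ∷ xs) =
      trans (⨁-++ f (g x) (concatMap g xs)) (cong (⨁ f (g x) ∙_) (⨁-concatMap f g xs))

    ⨁-filter : (p : B → Bool) (f : B → A) → ∀ xs →
      ⨁ f (filter (λ x → p x Data.Bool.≟ true) xs) ≡ ⨁ (λ x → if p x then f x else ε) xs
    ⨁-filter p f []       = refl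
    ⨁-filter p f (x ∷ xs) with p x
    ... | true  = cong (f x ∙_) (⨁-filter p f xs)
    ... | false = trans (⨁-filter p f xs) (sym (identityˡ _))

    ⨁-↭ : (f : B → A) → ∀ {xs ys} → xs ↭ ys → ⨁ f xs ≡ ⨁ f ys
    ⨁-↭ f ↭.refl         = refl
    ⨁-↭ f (↭.prep x p)   = cong (f x ∙_) (⨁-↭ f p)
    ⨁-↭ f (↭.swap x y p) = begin
      f x ∙ (f y ∙ _)  ≡⟨ assoc _ _ _ ⟨
      (f x ∙ f y) ∙ _  ≡⟨ cong₂ _∙_ (comm _ _) (⨁-↭ f p) ⟩
      (f y ∙ f x) ∙ _  ≡⟨ assoc _ _ _ ⟩
      f y ∙ (f x ∙ _)  ∎
    ⨁-↭ f (↭.trans p q)  = trans (⨁-↭ f p) (⨁-↭ f q)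

    ⨁-ε : {f : B → A} → ∀ xs → All (λ x → f x ≡ ε) xs → ⨁ f xs ≡ ε
    ⨁-ε []       []       = refl
    ⨁-ε (x ∷ xs) (p ∷ ps) = trans (cong₂ _∙_ p (⨁-ε xs ps)) (identityˡ ε)

    ⨁-single : {f : B → A} → ∀ {x xs} → Unique xs → x ∈ xs →
      (∀ y → y ≢ x → f y ≡ ε) → ⨁ f xs ≡ f x
    ⨁-single {f} {xs = y ∷ ys} (y∉ ∷ _) (here refl) off =
      trans (cong (f y ∙_) (⨁-ε ys (All.map (λ y≢z → off _ (y≢z ∘ sym)) y∉))) (identityʳ _)
    ⨁-single {f} {xs = y ∷ ys} (y∉ ∷ ys!) (there x∈) off =
      trans (cong₂ _∙_ (off y (All.lookup y∉ x∈)) (⨁-single ys! x∈ off)) (identityˡ _)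

open BigOp ℤP.+-0-isCommutativeMonoid using () renaming
  (⨁ to ∑; ⨁-cong to ∑-cong; ⨁-∙ to ∑-+; ⨁-map to ∑-map; ⨁-concatMap to ∑-concatMap;
   ⨁-filter to ∑-filter; ⨁-↭ to ∑-↭; ⨁-ε to ∑-0; ⨁-single to ∑-single)
open BigOp ℤP.*-1-isCommutativeMonoid using () renaming
  (⨁ to ∏; ⨁-cong to ∏-cong; ⨁-∙ to ∏-*; ⨁-map to ∏-map; ⨁-concatMap to ∏-concatMap;
   ⨁-ε to ∏-1; ⨁-single to ∏-single)
open BigOp ℚP.+-0-isCommutativeMonoid using () renaming
  (⨁ to ∑ℚ; ⨁-cong to ∑ℚ-cong; ⨁-∙ to ∑ℚ-+; ⨁-map to ∑ℚ-map; ⨁-↭ to ∑ℚ-↭;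
   ⨁-ε to ∑ℚ-0; ⨁-single to ∑ℚ-single)

∑-neg : {B : Set} (f : B → ℤ) → ∀ xs → ∑ (λ x → ℤ.- f x) xs ≡ ℤ.- ∑ f xs
∑-neg f []       = refl
∑-neg f (x ∷ xs) = trans (cong (ℤ._+_ (ℤ.- f x)) (∑-neg f xs)) (sym (ℤP.neg-distrib-+ (f x) (∑ f xs)))

-- Reduces each rearrangement used below, of coordinates or of positive roots, to two membership
-- checks.
unique-⇔⇒↭ : {A : Set} {xs ys : List A} → Unique xs → Unique ys →
  (∀ {x} → x ∈ xs → x ∈ ys) → (∀ {x} → x ∈ ys → x ∈ xs) → xs ↭ ys
unique-⇔⇒↭ xs! ys! f g = ∼bag⇒↭ (unique∧set⇒bag xs! ys! (mk⇔ f g))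

-- Pigeonhole: if `y` were missed, deleting it with `punchOut` would inject `Fin (suc n)` into
-- `Fin n`.
inject-endo⇒surject : ∀ {n} {f : Fin n → Fin n} → Injective _≡_ _≡_ f → ∀ y → ∃[ x ] f x ≡ y
inject-endo⇒surject {suc n} {f} inj y with FP.any? (λ x → f x ≟F y)
... | yes hit = hit
... | no miss = ⊥-elim (ℕP.1+n≰n (FP.injective⇒≤ {f = λ x → punchOut (y≢f x)} punched))
  where
  y≢f : ∀ x → y ≢ f x
  y≢f x eq = miss (x , sym eq)
  punched : Injective _≡_ _≡_ (λ x → punchOut (y≢f x))
  punched {a} {b} eq = inj (FP.punchOut-injective (y≢f a) (y≢f b) eq)

map-allFin-↭ : ∀ {n} {f : Fin n → Fin n} → Injective _≡_ _≡_ f → map f (allFin n) ↭ allFin n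
map-allFin-↭ {n} {f} inj = unique-⇔⇒↭ (Uniq.map⁺ inj (Uniq.allFin⁺ n)) (Uniq.allFin⁺ n)
  (λ _ → ∈-allFin _)
  (λ {y} _ → case inject-endo⇒surject inj y of λ { (x , refl) → ∈-map⁺ f (∈-allFin x) })

-- Boolean tests and the propositions they decide

module _ {A : Set} {p : A → Bool} where

  all⁺ : (∀ x → p x ≡ true) → ∀ xs → all p xs ≡ true
  all⁺ h []       = refl
  all⁺ h (x ∷ xs) rewrite h x = all⁺ h xs

  all⁻ : ∀ {x} xs → all p xs ≡ true → x ∈ xs → p x ≡ true
  all⁻ (x ∷ xs) h (here refl) with p x
  ... | true = refl
  all⁻ (x ∷ xs) h (there x∈) with p x
  ... | true = all⁻ xs h x∈

  all-false : ∀ xs → all p xs ≡ false → ∃[ x ] p x ≡ false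
  all-false (x ∷ xs) h with p x in eq
  ... | true  = all-false xs h
  ... | false = x , eq

true⇔true : ∀ {a b : Bool} → (a ≡ true → b ≡ true) → (b ≡ true → a ≡ true) → a ≡ b
true⇔true {true}  f g = sym (f refl)
true⇔true {false} {false} f g = refl
true⇔true {false} {true}  f g = g refl

isZeroW⁺ : ∀ {r} {x : Wt r} → x ≗ zeroW → isZeroW x ≡ true
isZeroW⁺ {x = x} x≗0 = all⁺ (λ a → helper (x a) (x≗0 a)) (allFin _)
  where
  helper : ∀ q → q ≡ 0ℚ → ⌊ q ℚP.≟ 0ℚ ⌋ ≡ true
  helper .0ℚ refl = refl

isZeroW⁻ : ∀ {r} {x : Wt r} → isZeroW x ≡ true → x ≗ zeroW
isZeroW⁻ {x = x} h a with x a ℚP.≟ 0ℚ | all⁻ {p = λ a → ⌊ x a ℚP.≟ 0ℚ ⌋} (allFin _) h (∈-allFin a)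
... | yes eq | _  = eq
... | no _   | ()

isZeroW-cong : ∀ {r} {x y : Wt r} → (x ≗ zeroW → y ≗ zeroW) → (y ≗ zeroW → x ≗ zeroW) →
  isZeroW x ≡ isZeroW y
isZeroW-cong {x = x} {y} f g =
  true⇔true (isZeroW⁺ ∘ f ∘ isZeroW⁻ {x = x}) (isZeroW⁺ ∘ g ∘ isZeroW⁻ {x = y})

-- The partition function of an arbitrary list of weights

_≋_ : ∀ {r} → List (Wt r) → List (Wt r) → Set
_≋_ = Pointwise _≗_

⊖-cong : ∀ {r} {x x′ y y′ : Wt r} → x ≗ x′ → y ≗ y′ → x ⊖ y ≗ x′ ⊖ y′
⊖-cong p q a = cong₂ ℚ._-_ (p a) (q a)

⊕-cong : ∀ {r} {x x′ y y′ : Wt r} → x ≗ x′ → y ≗ y′ → x ⊕ y ≗ x′ ⊕ y′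
⊕-cong p q a = cong₂ ℚ._+_ (p a) (q a)

ways-cong : ∀ {r} {βs γs : List (Wt r)} → βs ≋ γs → ∀ k {ξ ζ} → ξ ≗ ζ →
  ways βs k ξ ≡ ways γs k ζ
ways-cong [] zero    {ξ} {ζ} eq =
  cong (λ b → if b then 1 else 0)
    (isZeroW-cong {x = ξ} {ζ} (λ z a → trans (sym (eq a)) (z a)) (λ z a → trans (eq a) (z a)))
ways-cong [] (suc k) eq = refl
ways-cong (p ∷ ps) zero    eq = ways-cong ps zero eq
ways-cong (p ∷ ps) (suc k) eq =
  cong₂ _+_ (ways-cong ps (suc k) eq) (ways-cong (p ∷ ps) k (⊖-cong eq p))

≋-refl : ∀ {r} {βs : List (Wt r)} → βs ≋ βs
≋-refl = PW.refl (λ _ → refl)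

ways-congʳ : ∀ {r} (βs : List (Wt r)) k {ξ ζ} → ξ ≗ ζ → ways βs k ξ ≡ ways βs k ζ
ways-congʳ βs k = ways-cong (≋-refl {βs = βs}) k

⊖-comm : ∀ {r} (ξ β γ : Wt r) → ξ ⊖ β ⊖ γ ≗ ξ ⊖ γ ⊖ β
⊖-comm ξ β γ a =
  ℚSolver.+-*-Solver.solve 3 (λ x y z → (x :- y) :- z := (x :- z) :- y) refl (ξ a) (β a) (γ a)
  where open ℚSolver.+-*-Solver using (_:-_; _:=_)

-- Multisets are sorted into four classes: neither root used (`l`), only γ (`c`), only β (`b`), and
-- at least one of each. The description is symmetric in the two roots; induction is needed only to
-- expose the last class, whose two orders of subtraction agree by `⊖-comm`.
ways-swap : ∀ {r} (β γ : Wt r) L k ξ → ways (β ∷ γ ∷ L) k ξ ≡ ways (γ ∷ β ∷ L) k ξ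
ways-swap β γ L zero          ξ = refl
ways-swap β γ L (suc zero)    ξ = begin
  (l + ways L 0 (ξ ⊖ γ)) + ways L 0 (ξ ⊖ β)    ≡⟨ ℕP.+-assoc l _ _ ⟩
  l + (ways L 0 (ξ ⊖ γ) + ways L 0 (ξ ⊖ β))    ≡⟨ cong (l +_) (ℕP.+-comm (ways L 0 (ξ ⊖ γ)) _) ⟩
  l + (ways L 0 (ξ ⊖ β) + ways L 0 (ξ ⊖ γ))    ≡⟨ ℕP.+-assoc l _ _ ⟨
  (l + ways L 0 (ξ ⊖ β)) + ways L 0 (ξ ⊖ γ)    ∎
  where l = ways L 1 ξ
ways-swap β γ L (suc (suc k)) ξ = begin
  (l + c) + A (suc k) (ξ ⊖ β)      ≡⟨ cong ((l + c) +_) (ways-swap β γ L (suc k) (ξ ⊖ β)) ⟩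
  (l + c) + (b + B k (ξ ⊖ β ⊖ γ))  ≡⟨ interchange l c b _ ⟩
  (l + b) + (c + B k (ξ ⊖ β ⊖ γ))
    ≡⟨ cong (λ z → (l + b) + (c + z)) (ways-congʳ (γ ∷ β ∷ L) k (⊖-comm ξ β γ)) ⟩
  (l + b) + (c + B k (ξ ⊖ γ ⊖ β))
    ≡⟨ cong (λ z → (l + b) + (c + z)) (ways-swap β γ L k (ξ ⊖ γ ⊖ β)) ⟨
  (l + b) + A (suc k) (ξ ⊖ γ)      ≡⟨ cong ((l + b) +_) (ways-swap β γ L (suc k) (ξ ⊖ γ)) ⟩
  (l + b) + B (suc k) (ξ ⊖ γ)      ∎
  where
  open BigOp ℕP.+-0-isCommutativeMonoid using (interchange)
  A = ways (β ∷ γ ∷ L)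
  B = ways (γ ∷ β ∷ L)
  l = ways L (2 + k) ξ
  c = ways (γ ∷ L) (suc k) (ξ ⊖ γ)
  b = ways (β ∷ L) (suc k) (ξ ⊖ β)

ways-∷ : ∀ {r} (β : Wt r) {L L′} → (∀ k ξ → ways L k ξ ≡ ways L′ k ξ) →
  ∀ k ξ → ways (β ∷ L) k ξ ≡ ways (β ∷ L′) k ξ
ways-∷ β L≈L′ zero    ξ = L≈L′ zero ξ
ways-∷ β L≈L′ (suc k) ξ = cong₂ _+_ (L≈L′ (suc k) ξ) (ways-∷ β L≈L′ k (ξ ⊖ β))

ways-↭ : ∀ {r} {L L′ : List (Wt r)} → L ↭ L′ → ∀ k ξ → ways L k ξ ≡ ways L′ k ξ
ways-↭ ↭.refl         k ξ = refl
ways-↭ (↭.prep β p)   k ξ = ways-∷ β (ways-↭ p) k ξ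
ways-↭ (↭.swap β γ p) k ξ =
  trans (ways-swap β γ _ k ξ) (ways-∷ γ (ways-∷ β (ways-↭ p)) k ξ)
ways-↭ (↭.trans p q)  k ξ = trans (ways-↭ p k ξ) (ways-↭ q k ξ)

ways-∘ : ∀ {r} {τ : Fin (suc r) → Fin (suc r)} → (∀ a → τ (τ a) ≡ a) → (L : List (Wt r)) →
  ∀ k ξ → ways (map (_∘ τ) L) k (ξ ∘ τ) ≡ ways L k ξ
ways-∘ {τ = τ} inv []      zero    ξ =
  cong (λ b → if b then 1 else 0)
    (isZeroW-cong {x = ξ ∘ τ} {ξ} (λ z a → trans (cong ξ (sym (inv a))) (z (τ a))) (_∘ τ))
ways-∘ inv []      (suc k) ξ = refl
ways-∘ inv (β ∷ L) zero    ξ = ways-∘ inv L zero ξ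
ways-∘ inv (β ∷ L) (suc k) ξ = cong₂ _+_ (ways-∘ inv L (suc k) ξ) (ways-∘ inv (β ∷ L) k (ξ ⊖ β))

-- A linear functional positive on L certifies that the partition function on L vanishes.
module Positive {r} (h : Wt r → ℚ) (h-cong : ∀ {ξ ζ} → ξ ≗ ζ → h ξ ≡ h ζ)
  (h-0 : h zeroW ≡ 0ℚ) (h-⊖ : ∀ ξ ζ → h (ξ ⊖ ζ) ≡ h ξ ℚ.- h ζ) where

  private
    h-⊖-< : ∀ {ξ β} → 0ℚ ℚ.< h β → h ξ ℚ.≤ 0ℚ → h (ξ ⊖ β) ℚ.< 0ℚ
    h-⊖-< {ξ} {β} hβ hξ = subst (ℚ._< 0ℚ) (sym (h-⊖ ξ β))
      (subst (h ξ ℚ.- h β ℚ.<_) (ℚP.+-identityˡ 0ℚ) (ℚP.+-mono-≤-< hξ (ℚP.neg-antimono-< hβ)))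

  ways-neg : ∀ L → All (λ β → 0ℚ ℚ.< h β) L → ∀ k ξ → h ξ ℚ.< 0ℚ → ways L k ξ ≡ 0
  ways-neg [] [] zero ξ hξ with isZeroW ξ in eq
  ... | true  = ⊥-elim (ℚP.<-irrefl (trans (h-cong (isZeroW⁻ {x = ξ} eq)) h-0) hξ)
  ... | false = refl
  ways-neg []      []        (suc k) ξ hξ = refl
  ways-neg (β ∷ L) (p ∷ ps)  zero    ξ hξ = ways-neg L ps zero ξ hξ
  ways-neg (β ∷ L) (p ∷ ps)  (suc k) ξ hξ =
    cong₂ _+_ (ways-neg L ps (suc k) ξ hξ) (ways-neg (β ∷ L) (p ∷ ps) k (ξ ⊖ β) (h-⊖-< {ξ} {β} p (ℚP.<⇒≤ hξ)))

  -- In positive degree at least one root is subtracted, which makes the value of `h` negative.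
  -- Degree zero has to be left out, since the zero weight is counted once there.
  ways-nonpos : ∀ L → All (λ β → 0ℚ ℚ.< h β) L → ∀ k ξ → h ξ ℚ.≤ 0ℚ → ways L (suc k) ξ ≡ 0
  ways-nonpos []      []       k ξ hξ = refl
  ways-nonpos (β ∷ L) (p ∷ ps) k ξ hξ =
    cong₂ _+_ (ways-nonpos L ps k ξ hξ) (ways-neg (β ∷ L) (p ∷ ps) k (ξ ⊖ β) (h-⊖-< {ξ} {β} p hξ))

ways-zero : ∀ {r} (L : List (Wt r)) {ξ} → ξ ≗ zeroW → ways L 0 ξ ≡ 1
ways-zero []      {ξ} eq rewrite isZeroW⁺ {x = ξ} eq = refl
ways-zero (β ∷ L) eq = ways-zero L eq

-- Positive roots and their permutation by a simple reflection

module Transpose {A : Set} (_≟_ : DecidableEquality A) (x y : A) where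

  sw : A → A
  sw z = if does (z ≟ x) then y else if does (z ≟ y) then x else z

  sw-x : sw x ≡ y
  sw-x rewrite dec-true (x ≟ x) refl = refl

  sw-y : sw y ≡ x
  sw-y with y ≟ x
  ... | yes refl = refl
  ... | no _ rewrite dec-true (y ≟ y) refl = refl

  sw-other : ∀ {z} → z ≢ x → z ≢ y → sw z ≡ z
  sw-other {z} z≢x z≢y rewrite dec-false (z ≟ x) z≢x | dec-false (z ≟ y) z≢y = refl

  data Position : A → Set where
    at-x  : Position x
    at-y  : Position y
    other : ∀ {z} → z ≢ x → z ≢ y → Position z

  position : ∀ z → Position z
  position z with z ≟ x | z ≟ y
  ... | yes refl | _        = at-x
  ... | no _     | yes refl = at-y
  ... | no z≢x   | no z≢y   = other z≢x z≢y

  sw-inv : ∀ z → sw (sw z) ≡ z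
  sw-inv z with position z
  ... | at-x        = trans (cong sw sw-x) sw-y
  ... | at-y        = trans (cong sw sw-y) sw-x
  ... | other p q   = trans (cong sw (sw-other p q)) (sw-other p q)

  sw-injective : Injective _≡_ _≡_ sw
  sw-injective {a} {b} eq = trans (sym (sw-inv a)) (trans (cong sw eq) (sw-inv b))

module _ {A B : Set} (_≟A_ : DecidableEquality A) (_≟B_ : DecidableEquality B)
  {f : A → B} (f-inj : Injective _≡_ _≡_ f) {x y : A} {x′ y′ : B} (fx : f x ≡ x′) (fy : f y ≡ y′) where

  private
    module S = Transpose _≟A_ x y
    module T = Transpose _≟B_ x′ y′

  -- One reflection appears as a transposition of positions in `Fin`, of their numbers `toℕ a` and
  -- of the labels `toℕ a + 1` of basis vectors; this carries facts between the three.
  sw-natural : ∀ z → f (S.sw z) ≡ T.sw (f z)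
  sw-natural z with S.position z
  ... | S.at-x      = trans (cong f S.sw-x) (trans fy (trans (sym T.sw-x) (cong T.sw (sym fx))))
  ... | S.at-y      = trans (cong f S.sw-y) (trans fx (trans (sym T.sw-y) (cong T.sw (sym fy))))
  ... | S.other p q = trans (cong f (S.sw-other p q))
    (sym (T.sw-other (λ eq → p (f-inj (trans eq (sym fx)))) (λ eq → q (f-inj (trans eq (sym fy))))))

module Adjacent (c : ℕ) where

  open Transpose ℕP._≟_ c (suc c) public

  -- The order fact behind both uses of a simple reflection: it keeps every positive root except the
  -- simple one positive, and it changes the inversion status of a single pair of positions.
  sw-< : ∀ {a b} → a < b → (a , b) ≢ (c , suc c) → sw a < sw b
  sw-< {a} {b} a<b ne with position a | position b
  ... | at-x      | at-x      = ⊥-elim (ℕP.<-irrefl refl a<b)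
  ... | at-x      | at-y      = ⊥-elim (ne refl)
  ... | at-x      | other p q rewrite sw-x | sw-other p q = ℕP.≤∧≢⇒< a<b (q ∘ sym)
  ... | at-y      | at-x      = ⊥-elim (ℕP.<-asym a<b ℕP.≤-refl)
  ... | at-y      | at-y      = ⊥-elim (ℕP.<-irrefl refl a<b)
  ... | at-y      | other p q rewrite sw-y | sw-other p q = ℕP.<-trans ℕP.≤-refl a<b
  ... | other p q | at-x      rewrite sw-x | sw-other p q = ℕP.<-trans a<b ℕP.≤-refl
  ... | other p q | at-y      rewrite sw-y | sw-other p q = ℕP.≤∧≢⇒< (ℕP.≤-pred a<b) p
  ... | other p q | other p′ q′ rewrite sw-other p q | sw-other p′ q′ = a<b

  sw-≤ : ∀ {d a} → suc c ≤ d → a ≤ d → sw a ≤ d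
  sw-≤ {d} {a} c<d a≤d with position a
  ... | at-x      rewrite sw-x = c<d
  ... | at-y      rewrite sw-y = ℕP.≤-trans (ℕP.n≤1+n c) c<d
  ... | other p q rewrite sw-other p q = a≤d

  sw-≥ : ∀ {d a} → d ≤ c → d ≤ a → d ≤ sw a
  sw-≥ {d} {a} d≤c d≤a with position a
  ... | at-x      rewrite sw-x = ℕP.m≤n⇒m≤1+n d≤c
  ... | at-y      rewrite sw-y = d≤c
  ... | other p q rewrite sw-other p q = d≤a

  sw₂ : ℕ × ℕ → ℕ × ℕ
  sw₂ (a , b) = sw a , sw b

  sw₂-injective : Injective _≡_ _≡_ sw₂
  sw₂-injective eq = cong₂ _,_ (sw-injective (cong proj₁ eq)) (sw-injective (cong proj₂ eq))

  sw₂-inv : ∀ p → sw₂ (sw₂ p) ≡ p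
  sw₂-inv (a , b) = cong₂ _,_ (sw-inv a) (sw-inv b)

∈-range⁻ : ∀ {i r j} → j ∈ range i r → i ≤ j × j ≤ r
∈-range⁻ {i} {r} j∈ with t , t∈ , refl ← ∈-map⁻ (i +_) j∈ =
  ℕP.m≤m+n i t , ℕP.≤-pred (ℕP.≰⇒> (λ r<i+t → ℕP.<⇒≱ (∈-upTo⁻ t∈) (ℕP.m≤n+o⇒m∸n≤o (suc r) i r<i+t)))

∈-range⁺ : ∀ {i r j} → i ≤ j → j ≤ r → j ∈ range i r
∈-range⁺ {i} {r} {j} i≤j j≤r = subst (_∈ range i r) (ℕP.m+[n∸m]≡n i≤j)
  (∈-map⁺ (i +_) (∈-upTo⁺ (ℕP.∸-monoˡ-< (s≤s j≤r) i≤j)))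

range-unique : ∀ i r → Unique (range i r)
range-unique i r = Uniq.map⁺ (ℕP.+-cancelˡ-≡ i _ _) (Uniq.upTo⁺ _)

-- The pair (a , b) stands for the positive root e_a − e_b = α_{a,b−1}.
rootIndices : ℕ → List (ℕ × ℕ)
rootIndices r = concatMap (λ i → map (λ j → i , suc j) (range i r)) (range 1 r)

root : ∀ {r} → ℕ × ℕ → Wt r
root (a , b) = e a ⊖ e b

∈-rootIndices⁻ : ∀ {r a b} → (a , b) ∈ rootIndices r → 1 ≤ a × a < b × b ≤ suc r
∈-rootIndices⁻ {r} ab∈
  with i , i∈ , ab∈′ ← find (∈-concatMap⁻ (λ i → map (λ j → i , suc j) (range i r)) {xs = range 1 r} ab∈)
  with j , j∈ , refl ← ∈-map⁻ (λ j → i , suc j) ab∈′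
  = proj₁ (∈-range⁻ i∈) , s≤s (proj₁ (∈-range⁻ j∈)) , s≤s (proj₂ (∈-range⁻ j∈))

∈-rootIndices⁺ : ∀ {r a b} → 1 ≤ a → a < b → b ≤ suc r → (a , b) ∈ rootIndices r
∈-rootIndices⁺ {r} {a} 1≤a (s≤s a≤j) (s≤s j≤r) =
  ∈-concatMap⁺ (λ i → map (λ j → i , suc j) (range i r))
    (lose (∈-range⁺ 1≤a (ℕP.≤-trans a≤j j≤r)) (∈-map⁺ (λ j → a , suc j) (∈-range⁺ a≤j j≤r)))

rootIndices-unique : ∀ r → Unique (rootIndices r)
rootIndices-unique r = Uniq.concat⁺
  (AllP.map⁺ (All.universal (λ i → Uniq.map⁺ (λ { refl → refl }) (range-unique i r)) (range 1 r)))
  (AllPairsP.map⁺ (AllPairs.map disjoint (range-unique 1 r)))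
  where
  disjoint : ∀ {i i′} → i ≢ i′ → ∀ {p} →
    ¬ (p ∈ map (λ j → i , suc j) (range i r) × p ∈ map (λ j → i′ , suc j) (range i′ r))
  disjoint i≢i′ (p∈ , p∈′)
    with _ , _ , refl ← ∈-map⁻ _ p∈ | _ , _ , eq ← ∈-map⁻ _ p∈′ = i≢i′ (cong proj₁ eq)

concatMap-≋ : ∀ {r} {A B : Set} {f : A → List (Wt r)} {g : A → List B} {h : B → Wt r} →
  (∀ x → f x ≋ map h (g x)) → ∀ xs → concatMap f xs ≋ map h (concatMap g xs)
concatMap-≋ f≋ []       = []
concatMap-≋ {g = g} {h} f≋ (x ∷ xs) =
  subst (_ ≋_) (sym (map-++ h (g x) (concatMap g xs))) (PW.++⁺ (f≋ x) (concatMap-≋ f≋ xs))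

-- The summand `f` is abstract because `applyUpTo` recurses into `f ∘ suc`, whose values match the
-- shifted simple roots only after rewriting by `+-suc`.
telescope : ∀ {r} n i {f : ℕ → Wt r} → (∀ t → f t ≗ α (i + t)) → sumW (applyUpTo f n) ≗ e i ⊖ e (i + n)
telescope {r} zero i f≗ a rewrite ℕP.+-identityʳ i = sym (ℚP.+-inverseʳ (e {r} i a))
telescope {r} (suc n) i {f} f≗ a = begin
  f 0 a ℚ.+ sumW (applyUpTo (f ∘ suc) n) a
    ≡⟨ cong₂ ℚ._+_ (f≗ 0 a) (telescope n (suc i) (λ t a → trans (f≗ (suc t) a) (cong (λ m → α m a) (ℕP.+-suc i t))) a) ⟩
  α (i + 0) a ℚ.+ (e (suc i) ⊖ e (suc i + n)) a
    ≡⟨ cong₂ (λ m m′ → α m a ℚ.+ (e (suc i) ⊖ e m′) a) (ℕP.+-identityʳ i) (sym (ℕP.+-suc i n)) ⟩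
  α i a ℚ.+ (e (suc i) ⊖ e (i + suc n)) a
    ≡⟨ solve 3 (λ x y z → (x :- y) :+ (y :- z) := x :- z) refl (e {r} i a) (e {r} (suc i) a) (e {r} (i + suc n) a) ⟩
  (e i ⊖ e (i + suc n)) a ∎
  where open ℚSolver.+-*-Solver

-- The bound admits the empty interval `i = suc j`, where both sides are zero.
αr≗root : ∀ {r i j} → i ≤ suc j → αr {r} i j ≗ root (i , suc j)
αr≗root {r} {i} {j} i≤j a = begin
  sumW (map α (map (i +_) (applyUpTo id n))) a   ≡⟨ cong (λ L → sumW (map α L) a) (map-applyUpTo id (i +_) n) ⟩
  sumW (map α (applyUpTo (i +_) n)) a            ≡⟨ cong (λ L → sumW L a) (map-applyUpTo (i +_) α n) ⟩
  sumW (applyUpTo (λ t → α (i + t)) n) a         ≡⟨ telescope n i (λ _ _ → refl) a ⟩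
  (e i ⊖ e (i + n)) a                            ≡⟨ cong (λ m → root {r} (i , m) a) (ℕP.m+[n∸m]≡n i≤j) ⟩
  root (i , suc j) a ∎
  where n = suc j ∸ i

-- Passes to index pairs, on which a given root can be filtered out and lists can be compared as
-- sets.
posRoots≋ : ∀ r → posRoots r ≋ map root (rootIndices r)
posRoots≋ r = concatMap-≋ (λ i → row i (range i r) (All.tabulate (proj₁ ∘ ∈-range⁻))) (range 1 r)
  where
  row : ∀ i js → All (i ≤_) js → map (αr i) js ≋ map root (map (λ j → i , suc j) js)
  row i []       []       = []
  row i (j ∷ js) (p ∷ ps) = αr≗root (ℕP.m≤n⇒m≤1+n p) ∷ row i js ps

_≟ₚ_ : DecidableEquality (ℕ × ℕ)
_≟ₚ_ = ×-≡-dec ℕP._≟_ ℕP._≟_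

module OtherRoots {r c : ℕ} (1≤c : 1 ≤ c) (c≤r : c ≤ r) where

  open Adjacent c

  private
    simple? : (p : ℕ × ℕ) → Dec (p ≢ (c , suc c))
    simple? p = ¬? (p ≟ₚ (c , suc c))

  others : List (ℕ × ℕ)
  others = filter simple? (rootIndices r)

  others-unique : Unique others
  others-unique = Uniq.filter⁺ simple? (rootIndices-unique r)

  rootIndices-↭ : rootIndices r ↭ (c , suc c) ∷ others
  rootIndices-↭ = unique-⇔⇒↭ (rootIndices-unique r)
    (All.tabulate (λ p∈ eq → proj₂ (∈-filter⁻ simple? {xs = rootIndices r} p∈) (sym eq)) ∷ others-unique) to from
    where
    to : ∀ {p} → p ∈ rootIndices r → p ∈ (c , suc c) ∷ others
    to {p} p∈ with p ≟ₚ (c , suc c)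
    ... | yes eq = here eq
    ... | no ne  = there (∈-filter⁺ simple? p∈ ne)
    from : ∀ {p} → p ∈ (c , suc c) ∷ others → p ∈ rootIndices r
    from (here refl) = ∈-rootIndices⁺ 1≤c ℕP.≤-refl (s≤s c≤r)
    from (there p∈)  = proj₁ (∈-filter⁻ simple? p∈)

  sw₂-others : ∀ {p} → p ∈ others → sw₂ p ∈ others
  sw₂-others {a , b} p∈
    with p∈′ , ne ← ∈-filter⁻ simple? {xs = rootIndices r} p∈
    with 1≤a , a<b , b≤ ← ∈-rootIndices⁻ p∈′ =
    ∈-filter⁺ simple?
      (∈-rootIndices⁺ (sw-≥ 1≤c 1≤a) (sw-< a<b ne) (sw-≤ (s≤s c≤r) b≤))
      -- The image cannot be (c, c + 1): applying `sw` again would give a = c + 1 and b = c, against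
      -- a < b.
      λ eq → ℕP.<-asym a<b (subst₂ _<_
        (trans (sym sw-y) (sw-flip (cong proj₂ eq)))
        (trans (sym sw-x) (sw-flip (cong proj₁ eq))) ℕP.≤-refl)
    where
    sw-flip : ∀ {a c} → sw a ≡ c → sw c ≡ a
    sw-flip {a} eq = trans (cong sw (sym eq)) (sw-inv a)

  others-↭ : map sw₂ others ↭ others
  others-↭ = unique-⇔⇒↭ (Uniq.map⁺ sw₂-injective others-unique) others-unique to
    λ {p} p∈ → subst (_∈ map sw₂ others) (sw₂-inv p) (∈-map⁺ sw₂ (sw₂-others p∈))
    where
    to : ∀ {p} → p ∈ map sw₂ others → p ∈ others
    to p∈ with p , p∈′ , refl ← ∈-map⁻ sw₂ p∈ = sw₂-others p∈′

-- Sums over the Weyl group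

-- Two functions on `Fin` with equal values need not be propositionally equal, so a sum over
-- functions can be reindexed only when its summand does not see the difference.
Extensional : {A B C : Set} → ((A → B) → C) → Set
Extensional G = ∀ {f g} → f ≗ g → G f ≡ G g

-- `allFuns` builds its members with a local pattern-matching function that agrees with `b ∷ᶠ f`
-- only pointwise; extensionality of `G` bridges the two.
∑-allFuns : ∀ {m n} (G : (Fin (suc m) → Fin n) → ℤ) → Extensional G →
  ∑ G (allFuns (suc m) n) ≡ ∑ (λ b → ∑ (λ f → G (b ∷ᶠ f)) (allFuns m n)) (allFin n)
∑-allFuns {m} {n} G ext = trans (∑-concatMap G _ (allFin n))
  (∑-cong (λ b → trans (∑-map G _ (allFuns m n))
    (∑-cong (λ f → ext (λ { fzero → refl ; (fsuc a) → refl })) (allFuns m n))) (allFin n))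

∷ᶠ-cong : ∀ {m} {A : Set} (b : A) {f g : Fin m → A} → f ≗ g → (b ∷ᶠ f) ≗ (b ∷ᶠ g)
∷ᶠ-cong b eq fzero    = refl
∷ᶠ-cong b eq (fsuc a) = eq a

-- Composition with τ acts on each value of `f` separately, so the first value can be reindexed by a
-- permutation of `allFin n` and the remaining values by induction on the domain.
∑-allFuns-∘ : ∀ {n} {τ : Fin n → Fin n} → Injective _≡_ _≡_ τ →
  ∀ m (G : (Fin m → Fin n) → ℤ) → Extensional G → ∑ (λ f → G (τ ∘ f)) (allFuns m n) ≡ ∑ G (allFuns m n)
∑-allFuns-∘ inj zero G ext = cong (λ z → z ℤ.+ 0ℤ) (ext (λ ()))
∑-allFuns-∘ {n} {τ} inj (suc m) G ext = begin
  ∑ (λ f → G (τ ∘ f)) (allFuns (suc m) n)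
    ≡⟨ ∑-allFuns (λ f → G (τ ∘ f)) (λ eq → ext (cong τ ∘ eq)) ⟩
  ∑ (λ b → ∑ (λ f → G (τ ∘ (b ∷ᶠ f))) (allFuns m n)) (allFin n)
    ≡⟨ ∑-cong (λ b → trans
         (∑-cong (λ f → ext (λ { fzero → refl ; (fsuc a) → refl })) (allFuns m n))
         (∑-allFuns-∘ inj m (λ f → G (τ b ∷ᶠ f)) (λ eq → ext (∷ᶠ-cong (τ b) eq)))) (allFin n) ⟩
  ∑ (λ b → H (τ b)) (allFin n)   ≡⟨ ∑-map H τ (allFin n) ⟨
  ∑ H (map τ (allFin n))         ≡⟨ ∑-↭ H (map-allFin-↭ inj) ⟩
  ∑ H (allFin n)                 ≡⟨ ∑-allFuns G ext ⟨
  ∑ G (allFuns (suc m) n)        ∎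
  where
  H : Fin n → ℤ
  H b = ∑ (λ f → G (b ∷ᶠ f)) (allFuns m n)

∑-allFuns-single : ∀ {n} m (G : (Fin m → Fin n) → ℤ) → Extensional G →
  ∀ g → (∀ f → ¬ (f ≗ g) → G f ≡ 0ℤ) → ∑ G (allFuns m n) ≡ G g
∑-allFuns-single zero G ext g off = trans (ℤP.+-identityʳ _) (ext (λ ()))
∑-allFuns-single {n} (suc m) G ext g off = begin
  ∑ G (allFuns (suc m) n)  ≡⟨ ∑-allFuns G ext ⟩
  ∑ H (allFin n)
    ≡⟨ ∑-single (Uniq.allFin⁺ n) (∈-allFin (g fzero))
         (λ b b≢ → ∑-0 (allFuns m n) (All.universal (λ f → off _ (λ eq → b≢ (eq fzero))) (allFuns m n))) ⟩
  H (g fzero)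
    ≡⟨ ∑-allFuns-single m (λ f → G (g fzero ∷ᶠ f)) (λ eq → ext (∷ᶠ-cong _ eq)) (g ∘ fsuc)
         (λ f ne → off _ (λ eq → ne (eq ∘ fsuc))) ⟩
  G (g fzero ∷ᶠ (g ∘ fsuc))  ≡⟨ ext (λ { fzero → refl ; (fsuc a) → refl }) ⟩
  G g ∎
  where
  H : Fin n → ℤ
  H b = ∑ (λ f → G (b ∷ᶠ f)) (allFuns m n)

isInjective⁺ : ∀ {n} {σ : Fin n → Fin n} → Injective _≡_ _≡_ σ → isInjective σ ≡ true
isInjective⁺ {n} {σ} inj with isInjective σ in h
... | true  = refl
... | false with a , h₁ ← all-false (allFin n) h with b , h₂ ← all-false (allFin n) h₁
    with a ≟F b | σ a ≟F σ b | h₂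
...   | yes _  | _      | ()
...   | no _   | no _   | ()
...   | no a≢b | yes eq | _  = ⊥-elim (a≢b (inj eq))

isInjective⁻ : ∀ {n} {σ : Fin n → Fin n} → isInjective σ ≡ true → Injective _≡_ _≡_ σ
isInjective⁻ {n} {σ} h {a} {b} eq
  with a ≟F b | σ a ≟F σ b | all⁻ {x = b} (allFin n) (all⁻ {x = a} (allFin n) h (∈-allFin a)) (∈-allFin b)
... | yes a≡b | _      | _  = a≡b
... | no _    | yes _  | ()
... | no _    | no ne  | _  = ⊥-elim (ne eq)

isInjective-cong : ∀ {n} {σ σ′ : Fin n → Fin n} →
  (Injective _≡_ _≡_ σ → Injective _≡_ _≡_ σ′) → (Injective _≡_ _≡_ σ′ → Injective _≡_ _≡_ σ) →
  isInjective σ ≡ isInjective σ′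
isInjective-cong {σ = σ} {σ′} f g = true⇔true
  (λ h → isInjective⁺ {σ = σ′} (λ {a} {b} → f (λ {a} {b} → isInjective⁻ {σ = σ} h {a} {b}) {a} {b}))
  (λ h → isInjective⁺ {σ = σ} (λ {a} {b} → g (λ {a} {b} → isInjective⁻ {σ = σ′} h {a} {b}) {a} {b}))

module _ {r : ℕ} where

  private
    n : ℕ
    n = suc r

    onInjective : ((Fin n → Fin n) → ℤ) → (Fin n → Fin n) → ℤ
    onInjective F σ = if isInjective σ then F σ else 0ℤ

    onInjective-cong : ∀ {F F′ : (Fin n → Fin n) → ℤ} {σ σ′} →
      (Injective _≡_ _≡_ σ → Injective _≡_ _≡_ σ′) → (Injective _≡_ _≡_ σ′ → Injective _≡_ _≡_ σ) →
      (Injective _≡_ _≡_ σ → F σ ≡ F′ σ′) → onInjective F σ ≡ onInjective F′ σ′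
    onInjective-cong {F} {F′} {σ} {σ′} f g eq with isInjective σ in h | isInjective-cong {σ = σ} {σ′} f g
    ... | true  | h′ rewrite sym h′ = eq (λ {a} {b} → isInjective⁻ h {a} {b})
    ... | false | h′ rewrite sym h′ = refl

    onInjective-ext : ∀ {F} → Extensional F → Extensional (onInjective F)
    onInjective-ext {F} ext {σ} {σ′} eq = onInjective-cong {F} {F}
      (λ inj {a} {b} e → inj (trans (eq a) (trans e (sym (eq b)))))
      (λ inj {a} {b} e → inj (trans (sym (eq a)) (trans e (eq b))))
      (λ _ → ext eq)

    -- The filtered list has no recursive structure to induct on. Extending the summand by zero to
    -- all functions restores it.
    ∑-Weyl : ∀ F → ∑ F (Weyl r) ≡ ∑ (onInjective F) (allFuns n n)
    ∑-Weyl F = ∑-filter isInjective F (allFuns n n)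

  ∑-Weyl-cong : ∀ {F F′ : (Fin n → Fin n) → ℤ} → (∀ σ → Injective _≡_ _≡_ σ → F σ ≡ F′ σ) →
    ∑ F (Weyl r) ≡ ∑ F′ (Weyl r)
  ∑-Weyl-cong {F} {F′} eq = trans (∑-Weyl F)
    (trans (∑-cong (λ σ → onInjective-cong {F} {F′} {σ} {σ} (λ inj → inj) (λ inj → inj) (eq σ)) (allFuns n n))
      (sym (∑-Weyl F′)))

  ∑-Weyl-∘ : ∀ {τ : Fin n → Fin n} → Injective _≡_ _≡_ τ → ∀ {F} → Extensional F →
    ∑ (λ σ → F (τ ∘ σ)) (Weyl r) ≡ ∑ F (Weyl r)
  ∑-Weyl-∘ {τ} τ-inj {F} ext = begin
    ∑ (λ σ → F (τ ∘ σ)) (Weyl r)                           ≡⟨ ∑-Weyl _ ⟩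
    ∑ (onInjective (λ σ → F (τ ∘ σ))) (allFuns n n)
      ≡⟨ ∑-cong (λ σ → onInjective-cong {λ σ → F (τ ∘ σ)} {F} {σ} {τ ∘ σ}
           (λ inj e → inj (τ-inj e)) (λ inj e → inj (cong τ e)) (λ _ → refl)) (allFuns n n) ⟩
    ∑ (λ σ → onInjective F (τ ∘ σ)) (allFuns n n)
      ≡⟨ ∑-allFuns-∘ τ-inj n (onInjective F) (onInjective-ext ext) ⟩
    ∑ (onInjective F) (allFuns n n)                        ≡⟨ ∑-Weyl F ⟨
    ∑ F (Weyl r)                                           ∎

  ∑-Weyl-id : ∀ {F : (Fin n → Fin n) → ℤ} → Extensional F →
    (∀ σ → Injective _≡_ _≡_ σ → ¬ (σ ≗ id) → F σ ≡ 0ℤ) → ∑ F (Weyl r) ≡ F id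
  ∑-Weyl-id {F} ext off = begin
    ∑ F (Weyl r)                     ≡⟨ ∑-Weyl F ⟩
    ∑ (onInjective F) (allFuns n n)
      ≡⟨ ∑-allFuns-single n (onInjective F) (onInjective-ext ext) id off′ ⟩
    onInjective F id                 ≡⟨ cong (λ b → if b then F id else 0ℤ) (isInjective⁺ {n} {σ = id} (λ e → e)) ⟩
    F id                             ∎
    where
    off′ : ∀ σ → ¬ (σ ≗ id) → onInjective F σ ≡ 0ℤ
    off′ σ ne with isInjective σ in h
    ... | true  = off σ (λ {a} {b} → isInjective⁻ h {a} {b}) ne
    ... | false = refl

  ∑-Weyl-0 : ∀ {F : (Fin n → Fin n) → ℤ} → (∀ σ → Injective _≡_ _≡_ σ → F σ ≡ 0ℤ) → ∑ F (Weyl r) ≡ 0ℤ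
  ∑-Weyl-0 eq = trans (∑-Weyl-cong eq) (∑-0 (Weyl r) (All.universal (λ _ → refl) (Weyl r)))

-- Parity of the length

-1^ : Bool → ℤ
-1^ b = if b then -1ℤ else 1ℤ

sgn-suc : ∀ n → sgn (suc n) ≡ -1ℤ ℤ.* sgn n
sgn-suc zero          = refl
sgn-suc (suc zero)    = refl
sgn-suc (suc (suc n)) = sgn-suc n

sgn-square : ∀ n → sgn n ℤ.* sgn n ≡ 1ℤ
sgn-square zero          = refl
sgn-square (suc zero)    = refl
sgn-square (suc (suc n)) = sgn-square n

sgn-length-filter : {A : Set} (p : A → Bool) → ∀ xs →
  sgn (length (filter (λ x → p x Data.Bool.≟ true) xs)) ≡ ∏ (-1^ ∘ p) xs
sgn-length-filter p []       = refl
sgn-length-filter p (x ∷ xs) with p x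
... | true  = trans (sgn-suc (length (filter (λ x → p x Data.Bool.≟ true) xs)))
                (cong (-1ℤ ℤ.*_) (sgn-length-filter p xs))
... | false = trans (sgn-length-filter p xs) (sym (ℤP.*-identityˡ _))

inversion : ∀ {r} → (Fin (suc r) → Fin (suc r)) → Fin (suc r) → Fin (suc r) → Bool
inversion σ a b = (toℕ a <ᵇ toℕ b) ∧ (toℕ (σ b) <ᵇ toℕ (σ a))

module _ {n : ℕ} where

  ∏₂ : (Fin n → Fin n → ℤ) → ℤ
  ∏₂ f = ∏ (λ a → ∏ (f a) (allFin n)) (allFin n)

  ∏₂-cong : ∀ f g → (∀ a b → f a b ≡ g a b) → ∏₂ f ≡ ∏₂ g
  ∏₂-cong f g eq = ∏-cong {f = λ a → ∏ (f a) (allFin n)} {λ a → ∏ (g a) (allFin n)}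
    (λ a → ∏-cong {f = f a} {g a} (eq a) (allFin n)) (allFin n)

  ∏₂-* : ∀ f g → ∏₂ (λ a b → f a b ℤ.* g a b) ≡ ∏₂ f ℤ.* ∏₂ g
  ∏₂-* f g = trans
    (∏-cong {f = λ a → ∏ (λ b → f a b ℤ.* g a b) (allFin n)}
            {λ a → ∏ (f a) (allFin n) ℤ.* ∏ (g a) (allFin n)} (λ a → ∏-* (f a) (g a) (allFin n)) (allFin n))
    (∏-* (λ a → ∏ (f a) (allFin n)) (λ a → ∏ (g a) (allFin n)) (allFin n))

  ∏₂-1 : ∀ f → (∀ a b → f a b ≡ 1ℤ) → ∏₂ f ≡ 1ℤ
  ∏₂-1 f eq = ∏-1 {f = λ a → ∏ (f a) (allFin n)} (allFin n)
    (All.universal (λ a → ∏-1 {f = f a} (allFin n) (All.universal (eq a) (allFin n))) (allFin n))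

  ∏₂-single : ∀ f a₀ b₀ → (∀ a b → ¬ (a ≡ a₀ × b ≡ b₀) → f a b ≡ 1ℤ) → ∏₂ f ≡ f a₀ b₀
  ∏₂-single f a₀ b₀ off = trans
    (∏-single {f = λ a → ∏ (f a) (allFin n)} (Uniq.allFin⁺ n) (∈-allFin a₀) (λ a a≢ →
      ∏-1 {f = f a} (allFin n) (All.universal (λ b → off a b (a≢ ∘ proj₁)) (allFin n))))
    (∏-single {f = f a₀} (Uniq.allFin⁺ n) (∈-allFin b₀) (λ b b≢ → off a₀ b (b≢ ∘ proj₂)))

-- As a product over pairs, the sign can be compared with another sign factor by factor, with no
-- counting of inversions.
sgn-len : ∀ {r} (σ : Fin (suc r) → Fin (suc r)) → sgn (len σ) ≡ ∏₂ (λ a b → -1^ (inversion σ a b))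
sgn-len {r} σ = trans (sgn-length-filter inv (concatMap (λ a → map (λ b → a , b) (allFin (suc r))) (allFin (suc r))))
  (trans (∏-concatMap (-1^ ∘ inv) (λ a → map (λ b → a , b) (allFin (suc r))) (allFin (suc r)))
    (∏-cong {f = λ a → ∏ (-1^ ∘ inv) (map (λ b → a , b) (allFin (suc r)))}
            {λ a → ∏ (λ b → -1^ (inversion σ a b)) (allFin (suc r))}
      (λ a → ∏-map (-1^ ∘ inv) (λ b → (a , b)) (allFin (suc r))) (allFin (suc r))))
  where
  inv : Fin (suc r) × Fin (suc r) → Bool
  inv p = inversion σ (proj₁ p) (proj₂ p)

sgn-len-cong : ∀ {r} {σ σ′ : Fin (suc r) → Fin (suc r)} → σ ≗ σ′ → sgn (len σ) ≡ sgn (len σ′)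
sgn-len-cong {r} {σ} {σ′} eq = trans (sgn-len σ) (trans
  (∏₂-cong (λ a b → -1^ (inversion σ a b)) (λ a b → -1^ (inversion σ′ a b)) (λ a b →
    cong₂ (λ u v → -1^ ((toℕ a <ᵇ toℕ b) ∧ (toℕ u <ᵇ toℕ v))) (eq b) (eq a)))
  (sym (sgn-len σ′)))

sgn-len-id : ∀ r → sgn (len {r} id) ≡ 1ℤ
sgn-len-id r = trans (sgn-len {r} id)
  (∏₂-1 (λ a b → -1^ (inversion {r} id a b)) (λ a b → no-inversion (toℕ a) (toℕ b)))
  where
  no-inversion : ∀ x y → -1^ ((x <ᵇ y) ∧ (y <ᵇ x)) ≡ 1ℤ
  no-inversion zero    zero    = refl
  no-inversion zero    (suc y) = refl
  no-inversion (suc x) zero    = refl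
  no-inversion (suc x) (suc y) = no-inversion x y

-1^-square : ∀ b → -1^ b ℤ.* -1^ b ≡ 1ℤ
-1^-square true  = refl
-1^-square false = refl

<ᵇ-true : ∀ {x y} → x < y → (x <ᵇ y) ≡ true
<ᵇ-true {x} {y} x<y = dec-true (x ℕP.<? y) x<y

<ᵇ-false : ∀ {x y} → ¬ (x < y) → (x <ᵇ y) ≡ false
<ᵇ-false {x} {y} x≮y = dec-false (x ℕP.<? y) x≮y

module SimpleReflection {r : ℕ} (d : Fin r) where

  lo hi : Fin (suc r)
  lo = inject₁ d
  hi = fsuc d

  open Transpose _≟F_ lo hi public using () renaming
    (sw to τ; sw-x to τ-lo; sw-y to τ-hi; sw-inv to τ-inv; sw-injective to τ-injective)

  private
    module ℕ-sw = Adjacent (toℕ d)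

    toℕ-τ : ∀ a → toℕ (τ a) ≡ ℕ-sw.sw (toℕ a)
    toℕ-τ = sw-natural _≟F_ ℕP._≟_ FP.toℕ-injective (FP.toℕ-inject₁ d) refl

  module _ {σ : Fin (suc r) → Fin (suc r)} (σ-inj : Injective _≡_ _≡_ σ) where

    private
      -- The values at `a` and `b` are the two coordinates exchanged by τ, in either order.
      Moved : Fin (suc r) → Fin (suc r) → Set
      Moved a b = (σ a ≡ lo × σ b ≡ hi) ⊎ (σ a ≡ hi × σ b ≡ lo)

      moved : ∃[ a ] ∃[ b ] (toℕ a < toℕ b × Moved a b)
      moved with p , σp ← inject-endo⇒surject σ-inj lo | q , σq ← inject-endo⇒surject σ-inj hi
        with ℕP.<-cmp (toℕ p) (toℕ q)
      ... | tri< p<q _ _ = p , q , p<q , inj₁ (σp , σq)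
      ... | tri> _ _ q<p = q , p , q<p , inj₂ (σq , σp)
      ... | tri≈ _ p≡q _ = ⊥-elim (ℕP.1+n≢n (sym (trans (sym (FP.toℕ-inject₁ d))
              (cong toℕ (trans (sym σp) (trans (cong σ (FP.toℕ-injective p≡q)) σq))))))

      moved-unique : ∀ {a b a′ b′} → toℕ a < toℕ b → toℕ a′ < toℕ b′ → Moved a b → Moved a′ b′ →
        a ≡ a′ × b ≡ b′
      moved-unique _ _ (inj₁ (p , q)) (inj₁ (p′ , q′)) =
        σ-inj (trans p (sym p′)) , σ-inj (trans q (sym q′))
      moved-unique _ _ (inj₂ (p , q)) (inj₂ (p′ , q′)) =
        σ-inj (trans p (sym p′)) , σ-inj (trans q (sym q′))
      moved-unique a<b a′<b′ (inj₁ (p , q)) (inj₂ (p′ , q′))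
        with refl ← σ-inj (trans p (sym q′)) | refl ← σ-inj (trans q (sym p′)) = ⊥-elim (ℕP.<-asym a<b a′<b′)
      moved-unique a<b a′<b′ (inj₂ (p , q)) (inj₁ (p′ , q′))
        with refl ← σ-inj (trans p (sym q′)) | refl ← σ-inj (trans q (sym p′)) = ⊥-elim (ℕP.<-asym a<b a′<b′)

      -- The contribution of a pair to the product of the signs of `τ ∘ σ` and `σ`: it is -1 exactly
      -- when the inversion status of the pair changes.
      flip : Fin (suc r) → Fin (suc r) → ℤ
      flip a b = -1^ (inversion (τ ∘ σ) a b) ℤ.* -1^ (inversion σ a b)

      flip-moved : ∀ {a b} → toℕ a < toℕ b → Moved a b → flip a b ≡ -1ℤ
      flip-moved a<b (inj₁ (p , q)) rewrite <ᵇ-true a<b | p | q | τ-lo | τ-hi | FP.toℕ-inject₁ d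
        | <ᵇ-true (ℕP.n<1+n (toℕ d)) | <ᵇ-false (ℕP.<-asym (ℕP.n<1+n (toℕ d))) = refl
      flip-moved a<b (inj₂ (p , q)) rewrite <ᵇ-true a<b | p | q | τ-lo | τ-hi | FP.toℕ-inject₁ d
        | <ᵇ-true (ℕP.n<1+n (toℕ d)) | <ᵇ-false (ℕP.<-asym (ℕP.n<1+n (toℕ d))) = refl

      -- `sw-<` is used in both directions, the converse through the involution; each direction
      -- excludes one of the two orders in which the pair could be moved.
      preserved : ∀ {a b} → ¬ Moved a b → ¬ Moved b a →
        (toℕ (τ (σ b)) <ᵇ toℕ (τ (σ a))) ≡ (toℕ (σ b) <ᵇ toℕ (σ a))
      preserved {a} {b} ¬ab ¬ba rewrite toℕ-τ (σ a) | toℕ-τ (σ b) =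
        does-⇔ (mk⇔ back (λ lt → ℕ-sw.sw-< lt (¬ba ∘ from-labels)))
          (_ ℕP.<? _) (_ ℕP.<? _)
        where
        from-labels : ∀ {x y} → (toℕ (σ x) , toℕ (σ y)) ≡ (toℕ d , suc (toℕ d)) → Moved x y
        from-labels eq = inj₁ (FP.toℕ-injective (trans (cong proj₁ eq) (sym (FP.toℕ-inject₁ d)))
                              , FP.toℕ-injective (cong proj₂ eq))
        back : ℕ-sw.sw (toℕ (σ b)) < ℕ-sw.sw (toℕ (σ a)) → toℕ (σ b) < toℕ (σ a)
        back lt = subst₂ _<_ (ℕ-sw.sw-inv _) (ℕ-sw.sw-inv _) (ℕ-sw.sw-< lt λ eq →
          ¬ab (from-labels (cong₂ _,_
            (trans (sym (ℕ-sw.sw-inv _)) (trans (cong ℕ-sw.sw (cong proj₂ eq)) ℕ-sw.sw-y))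
            (trans (sym (ℕ-sw.sw-inv _)) (trans (cong ℕ-sw.sw (cong proj₁ eq)) ℕ-sw.sw-x)))))

      swap-moved : ∀ {a b} → Moved a b → Moved b a
      swap-moved (inj₁ (p , q)) = inj₂ (q , p)
      swap-moved (inj₂ (p , q)) = inj₁ (q , p)

      flip-fixed : ∀ {a b} → (toℕ a < toℕ b → ¬ Moved a b) → flip a b ≡ 1ℤ
      flip-fixed {a} {b} ¬moved with toℕ a ℕP.<? toℕ b
      ... | no a≮b  rewrite <ᵇ-false a≮b = refl
      ... | yes a<b rewrite <ᵇ-true a<b | preserved (¬moved a<b) (¬moved a<b ∘ swap-moved) =
        -1^-square (toℕ (σ b) <ᵇ toℕ (σ a))

      -- By bijectivity exactly one pair of positions a < b is sent to the two exchanged values. Its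
      -- factor is -1 and every other factor of the product is a square or trivial.
      sgn-product : sgn (len (τ ∘ σ)) ℤ.* sgn (len σ) ≡ -1ℤ
      sgn-product with a₀ , b₀ , a₀<b₀ , m₀ ← moved = begin
        sgn (len (τ ∘ σ)) ℤ.* sgn (len σ)   ≡⟨ cong₂ ℤ._*_ (sgn-len (τ ∘ σ)) (sgn-len σ) ⟩
        ∏₂ (λ a b → -1^ (inversion (τ ∘ σ) a b)) ℤ.* ∏₂ (λ a b → -1^ (inversion σ a b))
          ≡⟨ ∏₂-* (λ a b → -1^ (inversion (τ ∘ σ) a b)) (λ a b → -1^ (inversion σ a b)) ⟨
        ∏₂ flip
          ≡⟨ ∏₂-single flip a₀ b₀ (λ a b ne → flip-fixed {a} {b} (λ a<b m → ne (moved-unique a<b a₀<b₀ m m₀))) ⟩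
        flip a₀ b₀ ≡⟨ flip-moved a₀<b₀ m₀ ⟩
        -1ℤ ∎

    sgn-len-τ : sgn (len (τ ∘ σ)) ≡ ℤ.- sgn (len σ)
    sgn-len-τ = begin
      s′              ≡⟨ ℤP.*-identityʳ s′ ⟨
      s′ ℤ.* 1ℤ       ≡⟨ cong (s′ ℤ.*_) (sgn-square (len σ)) ⟨
      s′ ℤ.* (s ℤ.* s) ≡⟨ ℤP.*-assoc s′ s s ⟨
      s′ ℤ.* s ℤ.* s  ≡⟨ cong (ℤ._* s) sgn-product ⟩
      -1ℤ ℤ.* s       ≡⟨ ℤP.-1*i≡-i s ⟩
      ℤ.- s           ∎
      where
      s  = sgn (len σ)
      s′ = sgn (len (τ ∘ σ))

-- The action on weights and alternating sums

module _ {P Q : Set} where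

  ⌊⌋-⇔ : (P → Q) → (Q → P) → (p? : Dec P) (q? : Dec Q) → ⌊ p? ⌋ ≡ ⌊ q? ⌋
  ⌊⌋-⇔ f g p? q? = trans (isYes≗does p?) (trans (does-⇔ (mk⇔ f g) p? q?) (sym (isYes≗does q?)))

module _ {r : ℕ} where

  private
    n : ℕ
    n = suc r

    entry : (Fin n → Fin n) → Wt r → Fin n → Fin n → ℚ
    entry σ x b a = if ⌊ σ a ≟F b ⌋ then x a else 0ℚ

  act-cong : ∀ {σ σ′ : Fin n → Fin n} → σ ≗ σ′ → ∀ x → act σ x ≗ act σ′ x
  act-cong {σ} {σ′} eq x b = ∑ℚ-cong {f = entry σ x b} {entry σ′ x b}
    (λ a → cong (λ s → if ⌊ s ≟F b ⌋ then x a else 0ℚ) (eq a)) (allFin n)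

  act-image : ∀ {σ : Fin n → Fin n} → Injective _≡_ _≡_ σ → ∀ x a → act σ x (σ a) ≡ x a
  act-image {σ} inj x a = trans
    (∑ℚ-single {f = entry σ x (σ a)} (Uniq.allFin⁺ n) (∈-allFin a) off) on
    where
    off : ∀ b → b ≢ a → entry σ x (σ a) b ≡ 0ℚ
    off b b≢a with σ b ≟F σ a
    ... | yes eq = ⊥-elim (b≢a (inj eq))
    ... | no _   = refl
    on : entry σ x (σ a) a ≡ x a
    on with σ a ≟F σ a
    ... | yes _ = refl
    ... | no ne = ⊥-elim (ne refl)

  -- Acting by a permutation precomposes the coordinates with its inverse, and τ is its own inverse.
  act-∘ : ∀ {τ : Fin n → Fin n} → (∀ a → τ (τ a) ≡ a) → ∀ σ x → act (τ ∘ σ) x ≗ act σ x ∘ τ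
  act-∘ {τ} inv σ x b = ∑ℚ-cong {f = entry (τ ∘ σ) x b} {entry σ x (τ b)}
    (λ a → cong (λ t → if t then x a else 0ℚ) (⌊⌋-⇔
      (λ eq → trans (sym (inv (σ a))) (cong τ eq)) (λ eq → trans (cong τ eq) (inv b))
      (τ (σ a) ≟F b) (σ a ≟F τ b))) (allFin n)

  act-id : ∀ x → act id x ≗ x
  act-id x = act-image {id} id x

  weylTerm : List (Wt r) → Wt r → Wt r → ℕ → (Fin n → Fin n) → ℤ
  weylTerm L v x k σ = sgn (len σ) ℤ.* ℤ.+ (ways L k (act σ v ⊖ x))

  weylSum : List (Wt r) → Wt r → Wt r → ℕ → ℤ
  weylSum L v x k = ∑ (weylTerm L v x k) (Weyl r)

  weylTerm-ext : ∀ L v x k → Extensional (weylTerm L v x k)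
  weylTerm-ext L v x k {f} {g} eq = cong₂ (λ s w → s ℤ.* ℤ.+ w) (sgn-len-cong eq)
    (ways-congʳ L k (⊖-cong {y = x} (act-cong eq v) (λ _ → refl)))

  weylSum-cong : ∀ L v {x y} k → x ≗ y → weylSum L v x k ≡ weylSum L v y k
  weylSum-cong L v {x} {y} k eq = ∑-cong {f = weylTerm L v x k} {weylTerm L v y k}
    (λ σ → cong (λ w → sgn (len σ) ℤ.* ℤ.+ w)
      (ways-congʳ L k (⊖-cong {x = act σ v} (λ _ → refl) eq))) (Weyl r)

  weylSum-↭ : ∀ {L L′} v x k → L ↭ L′ → weylSum L v x k ≡ weylSum L′ v x k
  weylSum-↭ {L} {L′} v x k p = ∑-cong {f = weylTerm L v x k} {weylTerm L′ v x k}
    (λ σ → cong (λ w → sgn (len σ) ℤ.* ℤ.+ w) (ways-↭ p k (act σ v ⊖ x))) (Weyl r)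

  ⊖-⊕ : ∀ (ξ x β : Wt r) → ξ ⊖ x ⊖ β ≗ ξ ⊖ (x ⊕ β)
  ⊖-⊕ ξ x β a = solve 3 (λ p q s → (p :- q) :- s := p :- (q :+ s)) refl (ξ a) (x a) (β a)
    where open ℚSolver.+-*-Solver

  -- Subtracting β from σ v - x is the same as raising x by β, so the recursion of `ways` on its
  -- head survives the alternating sum.
  weylSum-∷ : ∀ β L v x k →
    weylSum (β ∷ L) v x (suc k) ≡ weylSum L v x (suc k) ℤ.+ weylSum (β ∷ L) v (x ⊕ β) k
  weylSum-∷ β L v x k = trans
    (∑-cong {f = weylTerm (β ∷ L) v x (suc k)}
            {λ σ → weylTerm L v x (suc k) σ ℤ.+ weylTerm (β ∷ L) v (x ⊕ β) k σ} split (Weyl r))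
    (∑-+ (weylTerm L v x (suc k)) (weylTerm (β ∷ L) v (x ⊕ β) k) (Weyl r))
    where
    split : ∀ σ → weylTerm (β ∷ L) v x (suc k) σ ≡
      weylTerm L v x (suc k) σ ℤ.+ weylTerm (β ∷ L) v (x ⊕ β) k σ
    split σ = trans (ℤP.*-distribˡ-+ (sgn (len σ)) (ℤ.+ ways L (suc k) (act σ v ⊖ x)) _)
      (cong (λ w → weylTerm L v x (suc k) σ ℤ.+ sgn (len σ) ℤ.* ℤ.+ w)
        (ways-congʳ (β ∷ L) k (⊖-⊕ (act σ v) x β)))

-- Coordinates of basis vectors and sums of lists of weights

e-label : ∀ {r} (a : Fin (suc r)) → e {r} (toℕ a + 1) a ≡ 1ℚ
e-label a = cong (λ b → if b then 1ℚ else 0ℚ) (dec-true (toℕ a + 1 ℕP.≟ toℕ a + 1) refl)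

e-other : ∀ {r k} {a : Fin (suc r)} → toℕ a + 1 ≢ k → e {r} k a ≡ 0ℚ
e-other {k = k} {a} ne = cong (λ b → if b then 1ℚ else 0ℚ) (dec-false (toℕ a + 1 ℕP.≟ k) ne)

roots : ∀ r → List (Wt r)
roots r = map root (rootIndices r)

sumW-apply : ∀ {r} (L : List (Wt r)) a → sumW L a ≡ ∑ℚ (λ β → β a) L
sumW-apply []      a = refl
sumW-apply (β ∷ L) a = cong (β a ℚ.+_) (sumW-apply L a)

sumW-↭ : ∀ {r} {L L′ : List (Wt r)} → L ↭ L′ → sumW L ≗ sumW L′
sumW-↭ {L = L} {L′} p a = trans (sumW-apply L a) (trans (∑ℚ-↭ (λ β → β a) p) (sym (sumW-apply L′ a)))

sumW-≋ : ∀ {r} {L L′ : List (Wt r)} → L ≋ L′ → sumW L ≗ sumW L′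
sumW-≋ []       a = refl
sumW-≋ (p ∷ ps) a = cong₂ ℚ._+_ (p a) (sumW-≋ ps a)

sumW-∘ : ∀ {r} (τ : Fin (suc r) → Fin (suc r)) (L : List (Wt r)) → sumW (map (_∘ τ) L) ≗ sumW L ∘ τ
sumW-∘ τ []      a = refl
sumW-∘ τ (β ∷ L) a = cong (β (τ a) ℚ.+_) (sumW-∘ τ L a)

-- Straightening of alternating sums

module Straightening {r : ℕ} (d : Fin r) where

  open SimpleReflection d

  c : ℕ
  c = suc (toℕ d)

  open Adjacent c
  open OtherRoots {r} {c} (s≤s z≤n) (FP.toℕ<n d)

  lo-label : toℕ lo + 1 ≡ c
  lo-label = trans (ℕP.+-comm (toℕ lo) 1) (cong suc (FP.toℕ-inject₁ d))

  hi-label : toℕ hi + 1 ≡ suc c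
  hi-label = ℕP.+-comm (toℕ hi) 1

  label-τ : ∀ a → toℕ (τ a) + 1 ≡ sw (toℕ a + 1)
  label-τ = sw-natural _≟F_ ℕP._≟_ {f = λ a → toℕ a + 1}
    (λ eq → FP.toℕ-injective (ℕP.+-cancelʳ-≡ 1 _ _ eq)) lo-label hi-label

  e-τ : ∀ k → e {r} k ∘ τ ≗ e (sw k)
  e-τ k a = cong (λ b → if b then 1ℚ else 0ℚ) (does-⇔
    (mk⇔ (λ eq → trans (sym (sw-inv _)) (cong sw (trans (sym (label-τ a)) eq)))
         (λ eq → trans (label-τ a) (trans (cong sw eq) (sw-inv k))))
    (toℕ (τ a) + 1 ℕP.≟ k) (toℕ a + 1 ℕP.≟ sw k))

  root-τ : ∀ p → root {r} p ∘ τ ≗ root (sw₂ p)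
  root-τ (i , m) = ⊖-cong (e-τ i) (e-τ m)

  otherRoots : List (Wt r)
  otherRoots = map root others

  roots-↭ : roots r ↭ α c ∷ otherRoots
  roots-↭ = Perm.map⁺ root rootIndices-↭

  otherRoots-↭ : map root (map sw₂ others) ↭ otherRoots
  otherRoots-↭ = Perm.map⁺ root others-↭

  otherRoots-∘τ : ∀ ps → map (_∘ τ) (map (root {r}) ps) ≋ map root (map sw₂ ps)
  otherRoots-∘τ []       = []
  otherRoots-∘τ (p ∷ ps) = root-τ p ∷ otherRoots-∘τ ps

  ways-otherRoots-τ : ∀ k ξ → ways otherRoots k (ξ ∘ τ) ≡ ways otherRoots k ξ
  ways-otherRoots-τ k ξ = begin
    ways otherRoots k (ξ ∘ τ)                     ≡⟨ ways-↭ otherRoots-↭ k (ξ ∘ τ) ⟨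
    ways (map root (map sw₂ others)) k (ξ ∘ τ)    ≡⟨ ways-cong (otherRoots-∘τ others) k (λ _ → refl) ⟨
    ways (map (_∘ τ) otherRoots) k (ξ ∘ τ)        ≡⟨ ways-∘ τ-inv otherRoots k ξ ⟩
    ways otherRoots k ξ                           ∎

  -- s_c permutes the positive roots other than α_c, so s_c ρ = ρ − α_c.
  ρ-τ : ρ r ∘ τ ≗ ρ r ⊖ α c
  ρ-τ a = begin
    ½ ℚ.* sumW (posRoots r) (τ a)               ≡⟨ cong (½ ℚ.*_) (split (τ a)) ⟩
    ½ ℚ.* (α c (τ a) ℚ.+ sumW otherRoots (τ a))
      ≡⟨ cong₂ (λ u w → ½ ℚ.* (u ℚ.+ w)) flipped invariant ⟩
    ½ ℚ.* ((e (suc c) a ℚ.- e c a) ℚ.+ sumW otherRoots a)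
      ≡⟨ solve 3 (λ x y s → con ½ :* ((y :- x) :+ s) := con ½ :* ((x :- y) :+ s) :- (x :- y)) refl
           (e {r} c a) (e {r} (suc c) a) (sumW otherRoots a) ⟩
    ½ ℚ.* (α c a ℚ.+ sumW otherRoots a) ℚ.- α c a
      ≡⟨ cong (λ s → ½ ℚ.* s ℚ.- α c a) (split a) ⟨
    ½ ℚ.* sumW (posRoots r) a ℚ.- α c a ∎
    where
    open ℚSolver.+-*-Solver using (solve; con; _:+_; _:-_; _:*_; _:=_)
    split : ∀ b → sumW (posRoots r) b ≡ α c b ℚ.+ sumW otherRoots b
    split b = trans (sumW-≋ (posRoots≋ r) b) (sumW-↭ roots-↭ b)
    flipped : α c (τ a) ≡ e (suc c) a ℚ.- e c a
    flipped = trans (root-τ (c , suc c) a) (cong₂ (λ i m → root {r} (i , m) a) sw-x sw-y)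
    invariant : sumW otherRoots (τ a) ≡ sumW otherRoots a
    invariant = trans (sym (sumW-∘ τ otherRoots a))
      (trans (sumW-≋ (otherRoots-∘τ others) a) (sumW-↭ otherRoots-↭ a))

  module _ (v : Wt r) where

    private
      M M′ : Wt r → ℕ → ℤ
      M  = weylSum (roots r) v
      M′ = weylSum otherRoots v

    -- Reindex by σ ↦ τ ∘ σ. The sign changes, while the argument becomes (σ v - x) ∘ τ, on which
    -- the partition function of the remaining roots takes the same value as on σ v - x.
    weylSum-otherRoots-τ : ∀ x k → M′ (x ∘ τ) k ≡ ℤ.- M′ x k
    weylSum-otherRoots-τ x k = begin
      M′ (x ∘ τ) k     ≡⟨ ∑-Weyl-∘ τ-injective {F} (weylTerm-ext otherRoots v (x ∘ τ) k) ⟨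
      ∑ (λ σ → F (τ ∘ σ)) (Weyl r)
        ≡⟨ ∑-Weyl-cong {F = λ σ → F (τ ∘ σ)} {λ σ → ℤ.- weylTerm otherRoots v x k σ} negate ⟩
      ∑ (λ σ → ℤ.- weylTerm otherRoots v x k σ) (Weyl r)
        ≡⟨ ∑-neg (weylTerm otherRoots v x k) (Weyl r) ⟩
      ℤ.- M′ x k       ∎
      where
      F : (Fin (suc r) → Fin (suc r)) → ℤ
      F = weylTerm otherRoots v (x ∘ τ) k
      negate : ∀ σ → Injective _≡_ _≡_ σ → F (τ ∘ σ) ≡ ℤ.- weylTerm otherRoots v x k σ
      negate σ inj = trans
        (cong₂ (λ s w → s ℤ.* ℤ.+ w) (sgn-len-τ inj) (trans
          (ways-congʳ otherRoots k (⊖-cong {y = x ∘ τ} (act-∘ τ-inv σ v) (λ _ → refl)))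
          (ways-otherRoots-τ k (act σ v ⊖ x))))
        (sym (ℤP.neg-distribˡ-* (sgn (len σ)) _))

    weylSum-zero : ∀ x → M x 0 ≡ M′ x 0
    weylSum-zero x = weylSum-↭ v x 0 roots-↭

    weylSum-suc : ∀ x k → M x (suc k) ≡ M′ x (suc k) ℤ.+ M (x ⊕ α c) k
    weylSum-suc x k = begin
      M x (suc k)                                                   ≡⟨ weylSum-↭ v x (suc k) roots-↭ ⟩
      weylSum (α c ∷ otherRoots) v x (suc k)                        ≡⟨ weylSum-∷ (α c) otherRoots v x k ⟩
      M′ x (suc k) ℤ.+ weylSum (α c ∷ otherRoots) v (x ⊕ α c) k
        ≡⟨ cong (λ z → M′ x (suc k) ℤ.+ z) (weylSum-↭ v (x ⊕ α c) k roots-↭) ⟨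
      M′ x (suc k) ℤ.+ M (x ⊕ α c) k                                ∎

    module _ {x : Wt r} (fixed : x ∘ τ ≗ x) where

      private
        M′≡0 : ∀ k → M′ x k ≡ 0ℤ
        M′≡0 k = self-neg (trans (sym (weylSum-cong otherRoots v k fixed)) (weylSum-otherRoots-τ x k))
          where
          self-neg : ∀ {z} → z ≡ ℤ.- z → z ≡ 0ℤ
          self-neg {ℤ.+ zero}   eq = refl
          self-neg {ℤ.+ suc _}  ()
          self-neg {ℤ.-[1+ _ ]} ()

      weylSum-fixed-zero : M x 0 ≡ 0ℤ
      weylSum-fixed-zero = trans (weylSum-zero x) (M′≡0 0)

      weylSum-fixed-suc : ∀ k → M x (suc k) ≡ M (x ⊕ α c) k
      weylSum-fixed-suc k = trans (weylSum-suc x k)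
        (trans (cong (ℤ._+ M (x ⊕ α c) k) (M′≡0 (suc k))) (ℤP.+-identityˡ _))

    module _ {x y : Wt r} (reflected : x ∘ τ ≗ y) (shifted : x ⊕ α c ≗ y) where

      private
        M′x : ∀ k → M′ x k ≡ ℤ.- M′ y k
        M′x k = trans (sym (ℤP.neg-involutive _)) (cong ℤ.-_
          (trans (sym (weylSum-otherRoots-τ x k)) (weylSum-cong otherRoots v k reflected)))

      weylSum-reflected-zero : M x 0 ≡ ℤ.- M y 0
      weylSum-reflected-zero = trans (weylSum-zero x) (trans (M′x 0) (cong ℤ.-_ (sym (weylSum-zero y))))

      -- The vanishing hypothesis is what lets M′(y) be traded back for M(y) in degree k + 1.
      weylSum-reflected-suc : ∀ k → M (y ⊕ α c) k ≡ 0ℤ → M x (suc k) ≡ ℤ.- M y (suc k) ℤ.+ M y k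
      weylSum-reflected-suc k vanish = begin
        M x (suc k)                       ≡⟨ weylSum-suc x k ⟩
        M′ x (suc k) ℤ.+ M (x ⊕ α c) k
          ≡⟨ cong₂ ℤ._+_ (M′x (suc k)) (weylSum-cong (roots r) v k shifted) ⟩
        ℤ.- M′ y (suc k) ℤ.+ M y k        ≡⟨ cong (λ z → ℤ.- z ℤ.+ M y k) My ⟨
        ℤ.- M y (suc k) ℤ.+ M y k         ∎
        where
        My : M y (suc k) ≡ M′ y (suc k)
        My = trans (weylSum-suc y k) (trans (cong (λ z → M′ y (suc k) ℤ.+ z) vanish) (ℤP.+-identityʳ _))

-- Positivity of squares and sums, and strictly decreasing weights

open GroupProperties ℚP.+-0-group using () renaming (∙-cancelʳ to ℚ-cancelʳ)

square-pos : ∀ {q} → q ≢ 0ℚ → 0ℚ ℚ.< q ℚ.* q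
square-pos {q} q≢0 with ℚP.<-cmp q 0ℚ
... | tri< q<0 _ _ = subst (ℚ._< q ℚ.* q) (ℚP.*-zeroˡ q) (ℚP.*-monoˡ-<-neg q {{ℚ.negative q<0}} q<0)
... | tri≈ _ q≡0 _ = ⊥-elim (q≢0 q≡0)
... | tri> _ _ 0<q = subst (ℚ._< q ℚ.* q) (ℚP.*-zeroˡ q) (ℚP.*-monoˡ-<-pos q {{ℚ.positive 0<q}} 0<q)

square-nonneg : ∀ q → 0ℚ ℚ.≤ q ℚ.* q
square-nonneg q with q ℚP.≟ 0ℚ
... | yes refl = ℚP.≤-refl
... | no q≢0   = ℚP.<⇒≤ (square-pos q≢0)

∑ℚ-nonneg : {B : Set} (f : B → ℚ) → (∀ x → 0ℚ ℚ.≤ f x) → ∀ xs → 0ℚ ℚ.≤ ∑ℚ f xs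
∑ℚ-nonneg f f≥0 []       = ℚP.≤-refl
∑ℚ-nonneg f f≥0 (x ∷ xs) = ℚP.+-mono-≤ (f≥0 x) (∑ℚ-nonneg f f≥0 xs)

∑ℚ-pos : {B : Set} (f : B → ℚ) → (∀ x → 0ℚ ℚ.≤ f x) → ∀ {x xs} → x ∈ xs → 0ℚ ℚ.< f x → 0ℚ ℚ.< ∑ℚ f xs
∑ℚ-pos f f≥0 {xs = _ ∷ xs} (here refl) fx>0 = ℚP.+-mono-<-≤ fx>0 (∑ℚ-nonneg f f≥0 xs)
∑ℚ-pos f f≥0 {xs = y ∷ _}  (there x∈)  fx>0 = ℚP.+-mono-≤-< (f≥0 y) (∑ℚ-pos f f≥0 x∈ fx>0)

stepwise-decreasing : ∀ {r} (f : Fin (suc r) → ℚ) → (∀ d → f (fsuc d) ℚ.< f (inject₁ d)) →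
  ∀ {a b} → toℕ a < toℕ b → f b ℚ.< f a
stepwise-decreasing f step {fzero} {fsuc fzero} _ = step fzero
stepwise-decreasing f step {fzero} {fsuc (fsuc b)} _ =
  ℚP.<-trans (stepwise-decreasing (f ∘ fsuc) (step ∘ fsuc) {fzero} {fsuc b} (s≤s z≤n)) (step fzero)
stepwise-decreasing {suc r} f step {fsuc a} {fsuc b} (s≤s a<b) =
  stepwise-decreasing (f ∘ fsuc) (step ∘ fsuc) {a} {b} a<b

unlabel : ∀ {r i} → 1 ≤ i → i ≤ suc r → ∃[ a ] i ≡ toℕ {suc r} a + 1
unlabel {i = suc i} _ i<n = fromℕ< i<n , trans (ℕP.+-comm 1 i) (cong (_+ 1) (sym (FP.toℕ-fromℕ< i<n)))

-- Alternating sums at a regular dominant weight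

module Regular {r : ℕ} (v : Wt r) (decreasing : ∀ {a b} → toℕ a < toℕ b → v b ℚ.< v a) where

  private
    indices : List (Fin (suc r))
    indices = allFin (suc r)

  v-injective : ∀ {a b} → v a ≡ v b → a ≡ b
  v-injective {a} {b} eq with ℕP.<-cmp (toℕ a) (toℕ b)
  ... | tri< a<b _ _ = ⊥-elim (ℚP.<-irrefl (sym eq) (decreasing a<b))
  ... | tri≈ _ a≡b _ = FP.toℕ-injective a≡b
  ... | tri> _ _ b<a = ⊥-elim (ℚP.<-irrefl eq (decreasing b<a))

  ⟨v,_⟩ : Wt r → ℚ
  ⟨v, ξ ⟩ = ∑ℚ (λ a → v a ℚ.* ξ a) indices

  pairing-cong : ∀ {ξ ζ} → ξ ≗ ζ → ⟨v, ξ ⟩ ≡ ⟨v, ζ ⟩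
  pairing-cong {ξ} {ζ} eq = ∑ℚ-cong {f = λ a → v a ℚ.* ξ a} {λ a → v a ℚ.* ζ a}
    (λ a → cong (v a ℚ.*_) (eq a)) indices

  pairing-0 : ⟨v, zeroW ⟩ ≡ 0ℚ
  pairing-0 = ∑ℚ-0 {f = λ a → v a ℚ.* 0ℚ} indices (All.universal (λ a → ℚP.*-zeroʳ (v a)) indices)

  pairing-⊖ : ∀ ξ ζ → ⟨v, ξ ⊖ ζ ⟩ ≡ ⟨v, ξ ⟩ ℚ.- ⟨v, ζ ⟩
  pairing-⊖ ξ ζ = begin
    D                          ≡⟨ solve 2 (λ x y → x := (x :+ y) :- y) refl D ⟨v, ζ ⟩ ⟩
    (D ℚ.+ ⟨v, ζ ⟩) ℚ.- ⟨v, ζ ⟩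
      ≡⟨ cong (ℚ._- ⟨v, ζ ⟩) (∑ℚ-+ (λ a → v a ℚ.* (ξ a ℚ.- ζ a)) (λ a → v a ℚ.* ζ a) indices) ⟨
    ∑ℚ (λ a → v a ℚ.* (ξ a ℚ.- ζ a) ℚ.+ v a ℚ.* ζ a) indices ℚ.- ⟨v, ζ ⟩
      ≡⟨ cong (ℚ._- ⟨v, ζ ⟩) (∑ℚ-cong {f = λ a → v a ℚ.* (ξ a ℚ.- ζ a) ℚ.+ v a ℚ.* ζ a} {λ a → v a ℚ.* ξ a}
           (λ a → solve 3 (λ w x y → w :* (x :- y) :+ w :* y := w :* x) refl (v a) (ξ a) (ζ a)) indices) ⟩
    ⟨v, ξ ⟩ ℚ.- ⟨v, ζ ⟩ ∎
    where
    open ℚSolver.+-*-Solver using (solve; _:+_; _:-_; _:*_; _:=_)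
    D = ⟨v, ξ ⊖ ζ ⟩

  pairing-e : ∀ {i} a → i ≡ toℕ a + 1 → ⟨v, e i ⟩ ≡ v a
  pairing-e a refl = trans
    (∑ℚ-single {f = λ b → v b ℚ.* e (toℕ a + 1) b} (Uniq.allFin⁺ (suc r)) (∈-allFin a) (λ b b≢a →
      trans (cong (v b ℚ.*_) (e-other (λ eq → b≢a (FP.toℕ-injective (ℕP.+-cancelʳ-≡ 1 _ _ eq)))))
        (ℚP.*-zeroʳ (v b))))
    (trans (cong (v a ℚ.*_) (e-label a)) (ℚP.*-identityʳ (v a)))

  -- The pairing with e_a - e_b is the difference of two entries of `v`, positive because the
  -- entries decrease strictly.
  pairing-root : ∀ {i m} → (i , m) ∈ rootIndices r → 0ℚ ℚ.< ⟨v, root (i , m) ⟩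
  pairing-root {i} {m} im∈ with 1≤i , i<m , m≤ ← ∈-rootIndices⁻ im∈
    with a , i≡ ← unlabel 1≤i (ℕP.≤-trans (ℕP.<⇒≤ i<m) m≤) | b , m≡ ← unlabel (ℕP.≤-trans 1≤i (ℕP.<⇒≤ i<m)) m≤ =
    subst (0ℚ ℚ.<_) (sym (trans (pairing-⊖ (e i) (e m)) (cong₂ ℚ._-_ (pairing-e a i≡) (pairing-e b m≡))))
      (subst (ℚ._< v a ℚ.- v b) (ℚP.+-inverseʳ (v b)) (ℚP.+-monoˡ-< (ℚ.- v b) (decreasing (ℕP.+-cancelʳ-< 1 _ _ (subst₂ _<_ i≡ m≡ i<m)))))

  open Positive {r} ⟨v,_⟩ pairing-cong pairing-0 pairing-⊖

  roots-positive : All (λ β → 0ℚ ℚ.< ⟨v, β ⟩) (roots r)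
  roots-positive = AllP.map⁺ (All.tabulate pairing-root)

  -- 2⟨v, w − v⟩ = −|w − v|² whenever |w| = |v|, in particular for w = σ v.
  module _ {σ : Fin (suc r) → Fin (suc r)} (σ-inj : Injective _≡_ _≡_ σ) where

    private
      w : Wt r
      w = act σ v
      s : Fin (suc r) → ℚ
      s a = (w a ℚ.- v a) ℚ.* (w a ℚ.- v a)
      D S W V : ℚ
      D = ⟨v, w ⊖ v ⟩
      S = ∑ℚ s indices
      W = ∑ℚ (λ a → w a ℚ.* w a) indices
      V = ∑ℚ (λ a → v a ℚ.* v a) indices

      W≡V : W ≡ V
      W≡V = begin
        W                                              ≡⟨ ∑ℚ-↭ (λ a → w a ℚ.* w a) (map-allFin-↭ σ-inj) ⟨
        ∑ℚ (λ a → w a ℚ.* w a) (map σ indices)         ≡⟨ ∑ℚ-map (λ a → w a ℚ.* w a) σ indices ⟩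
        ∑ℚ (λ a → w (σ a) ℚ.* w (σ a)) indices
          ≡⟨ ∑ℚ-cong {f = λ a → w (σ a) ℚ.* w (σ a)} {λ a → v a ℚ.* v a}
               (λ a → cong₂ ℚ._*_ (act-image σ-inj v a) (act-image σ-inj v a)) indices ⟩
        V ∎

      expand : D ℚ.+ D ℚ.+ S ℚ.+ V ≡ W
      expand = begin
        D ℚ.+ D ℚ.+ S ℚ.+ V
          ≡⟨ cong (λ z → z ℚ.+ S ℚ.+ V) (∑ℚ-+ f f indices) ⟨
        ∑ℚ (λ a → f a ℚ.+ f a) indices ℚ.+ S ℚ.+ V
          ≡⟨ cong (ℚ._+ V) (∑ℚ-+ (λ a → f a ℚ.+ f a) s indices) ⟨
        ∑ℚ (λ a → f a ℚ.+ f a ℚ.+ s a) indices ℚ.+ V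
          ≡⟨ ∑ℚ-+ (λ a → f a ℚ.+ f a ℚ.+ s a) (λ a → v a ℚ.* v a) indices ⟨
        ∑ℚ (λ a → f a ℚ.+ f a ℚ.+ s a ℚ.+ v a ℚ.* v a) indices
          ≡⟨ ∑ℚ-cong {f = λ a → f a ℚ.+ f a ℚ.+ s a ℚ.+ v a ℚ.* v a} {λ a → w a ℚ.* w a}
               (λ a → solve 2 (λ x y → y :* (x :- y) :+ y :* (x :- y) :+ (x :- y) :* (x :- y) :+ y :* y := x :* x)
                 refl (w a) (v a)) indices ⟩
        W ∎
        where
        open ℚSolver.+-*-Solver using (solve; _:+_; _:-_; _:*_; _:=_)
        f : Fin (suc r) → ℚ
        f a = v a ℚ.* (w a ℚ.- v a)

      DDS≡0 : D ℚ.+ D ℚ.+ S ≡ 0ℚ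
      DDS≡0 = ℚ-cancelʳ V _ _ (trans expand (trans W≡V (sym (ℚP.+-identityˡ V))))

    pairing-orbit-≤ : ⟨v, act σ v ⊖ v ⟩ ℚ.≤ 0ℚ
    pairing-orbit-≤ = ℚP.≮⇒≥ λ D>0 → ℚP.<-irrefl (sym DDS≡0)
      (ℚP.+-mono-<-≤ (ℚP.+-mono-< {0ℚ} {D} {0ℚ} {D} D>0 D>0) (∑ℚ-nonneg s (λ a → square-nonneg (w a ℚ.- v a)) indices))

    -- If σ moves `a`, then σ v has the entry `v a` at position `σ a`, where `v` has a different one
    -- because its entries are distinct. Hence |σ v - v|² has a positive term.
    pairing-orbit-< : ¬ (σ ≗ id) → ⟨v, act σ v ⊖ v ⟩ ℚ.< 0ℚ
    pairing-orbit-< σ≢id with a , σa≢a ← FP.¬∀⟶∃¬ (suc r) (λ a → σ a ≡ a) (λ a → σ a ≟F a) σ≢id =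
      ℚP.≰⇒> λ D≥0 → ℚP.<-irrefl (sym DDS≡0)
        (ℚP.+-mono-≤-< (ℚP.+-mono-≤ {0ℚ} {D} {0ℚ} {D} D≥0 D≥0) (∑ℚ-pos s (λ a → square-nonneg (w a ℚ.- v a)) (∈-allFin (σ a))
          (square-pos (λ eq → σa≢a (v-injective (sym (trans (sym (act-image σ-inj v a)) (difference eq))))))))
      where
      difference : ∀ {x y} → x ℚ.- y ≡ 0ℚ → x ≡ y
      difference {x} {y} eq = ℚ-cancelʳ (ℚ.- y) x y (trans eq (sym (ℚP.+-inverseʳ y)))

  weylSum-self-zero : weylSum (roots r) v v 0 ≡ 1ℤ
  weylSum-self-zero = trans
    (∑-Weyl-id {F = weylTerm (roots r) v v 0} (weylTerm-ext (roots r) v v 0) (λ σ inj σ≢id →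
      trans (cong (λ w → sgn (len σ) ℤ.* ℤ.+ w)
        (ways-neg (roots r) roots-positive 0 (act σ v ⊖ v) (pairing-orbit-< inj σ≢id))) (ℤP.*-zeroʳ (sgn (len σ)))))
    (cong₂ (λ s w → s ℤ.* ℤ.+ w) (sgn-len-id r) (ways-zero (roots r) {act id v ⊖ v}
      (λ a → trans (cong (ℚ._- v a) (act-id v a)) (ℚP.+-inverseʳ (v a)))))

  -- In positive degree the identity contributes nothing either: zero is not a sum of one or more
  -- positive roots. So the weak inequality on the orbit covers every σ at once.
  weylSum-self-suc : ∀ k → weylSum (roots r) v v (suc k) ≡ 0ℤ
  weylSum-self-suc k = ∑-Weyl-0 {F = weylTerm (roots r) v v (suc k)} λ σ inj →
    trans (cong (λ w → sgn (len σ) ℤ.* ℤ.+ w)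
      (ways-nonpos (roots r) roots-positive k (act σ v ⊖ v) (pairing-orbit-≤ inj))) (ℤP.*-zeroʳ (sgn (len σ)))

  weylSum-above : ∀ {β} → 0ℚ ℚ.< ⟨v, β ⟩ → ∀ k → weylSum (roots r) v (v ⊕ β) k ≡ 0ℤ
  weylSum-above {β} β>0 k = ∑-Weyl-0 {F = weylTerm (roots r) v (v ⊕ β) k} λ σ inj →
    trans (cong (λ w → sgn (len σ) ℤ.* ℤ.+ w)
      (ways-neg (roots r) roots-positive k (act σ v ⊖ (v ⊕ β)) (below σ inj))) (ℤP.*-zeroʳ (sgn (len σ)))
    where
    below : ∀ σ → Injective _≡_ _≡_ σ → ⟨v, act σ v ⊖ (v ⊕ β) ⟩ ℚ.< 0ℚ
    below σ inj = subst (ℚ._< 0ℚ)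
      (trans (sym (pairing-⊖ (act σ v ⊖ v) β)) (pairing-cong (⊖-⊕ (act σ v) v β)))
      (ℚP.+-mono-≤-< (pairing-orbit-≤ inj) (ℚP.neg-antimono-< β>0))

-- Strict dominance of θ + ρ

e-nonneg : ∀ {r} k (a : Fin (suc r)) → 0ℚ ℚ.≤ e {r} k a
e-nonneg k a with does (toℕ a + 1 ℕP.≟ k)
... | true  = ℚP.nonNegative⁻¹ 1ℚ
... | false = ℚP.≤-refl

θ≗root : ∀ r → θ r ≗ root (1 , suc r)
θ≗root r = αr≗root (s≤s z≤n)

θ⊕ρ-decreasing : ∀ {r a b} → toℕ a < toℕ b → (θ r ⊕ ρ r) b ℚ.< (θ r ⊕ ρ r) a
θ⊕ρ-decreasing {r} = stepwise-decreasing (θ r ⊕ ρ r) λ d → ℚP.+-mono-≤-< (θ-step d) (ρ-step d)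
  where
  module _ (d : Fin r) where
    open SimpleReflection d
    open Straightening d using (c; lo-label; hi-label; ρ-τ)

    -- Zero separates the two entries: the coefficient of θ can be positive only at label 1, which
    -- is not the label of `hi`, and negative only at label r + 1, which is not the label of `lo`.
    θ-step : θ r hi ℚ.≤ θ r lo
    θ-step = subst₂ ℚ._≤_ (sym (θ≗root r hi)) (sym (θ≗root r lo)) (ℚP.≤-trans θhi≤0 0≤θlo)
      where
      θhi≤0 : root {r} (1 , suc r) hi ℚ.≤ 0ℚ
      θhi≤0 = subst (λ z → z ℚ.- e {r} (suc r) hi ℚ.≤ 0ℚ)
        (sym (e-other {r} {1} {hi} (λ eq → ℕP.1+n≢0 (ℕP.suc-injective (trans (sym hi-label) eq)))))
        (subst (ℚ._≤ 0ℚ) (sym (ℚP.+-identityˡ (ℚ.- e {r} (suc r) hi))) (ℚP.neg-antimono-≤ (e-nonneg (suc r) hi)))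
      0≤θlo : 0ℚ ℚ.≤ root {r} (1 , suc r) lo
      0≤θlo = subst (λ z → 0ℚ ℚ.≤ e {r} 1 lo ℚ.- z)
        (sym (e-other {r} {suc r} {lo} (λ eq → ℕP.<⇒≢ (FP.toℕ<n d) (ℕP.suc-injective (trans (sym lo-label) eq)))))
        (subst (0ℚ ℚ.≤_) (sym (ℚP.+-identityʳ (e {r} 1 lo))) (e-nonneg 1 lo))

    -- Evaluating s_c ρ = ρ - α_c at `lo` shows that consecutive entries of ρ differ by exactly 1,
    -- with no closed formula for ρ.
    ρ-step : ρ r hi ℚ.< ρ r lo
    ρ-step = subst₂ ℚ._<_ drop (ℚP.+-identityʳ (ρ r lo)) (ℚP.+-monoʳ-< (ρ r lo) (ℚP.negative⁻¹ (ℚ.- 1ℚ)))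
      where
      drop : ρ r lo ℚ.- 1ℚ ≡ ρ r hi
      drop = begin
        ρ r lo ℚ.- (1ℚ ℚ.- 0ℚ)   ≡⟨ cong₂ (λ x y → ρ r lo ℚ.- (x ℚ.- y))
                                      (trans (cong (λ k → e {r} k lo) (sym lo-label)) (e-label lo))
                                      (e-other {r} {suc c} {lo} (λ eq → ℕP.1+n≢n (sym (trans (sym lo-label) eq)))) ⟨
        ρ r lo ℚ.- α c lo         ≡⟨ ρ-τ lo ⟨
        ρ r (τ lo)                ≡⟨ cong (ρ r) τ-lo ⟩
        ρ r hi                    ∎

-- Evaluation along the chain of shifted weights

module _ {r : ℕ} where

  private
    v : Wt r
    v = θ r ⊕ ρ r
    M : Wt r → ℕ → ℤ
    M = weylSum (roots r) v

  -- ρ + α_{1,p−1} + α_{t,r}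
  shiftedWeight : ℕ → ℕ → Wt r
  shiftedWeight p t = ρ r ⊕ (root (1 , p) ⊕ root (t , suc r))

  module _ (d : Fin r) where

    open SimpleReflection d using (τ)
    open Straightening d
    open Adjacent c
    open Regular v θ⊕ρ-decreasing
    open ℚSolver.+-*-Solver using (solve; _:+_; _:-_; _:*_; _:=_)

    private
      -- Labels 1 and r + 1 lie outside {c, c + 1} and stay put. The image of `t` is left as `sw t`,
      -- so that the fixed case and the adjacent case share this computation.
      shiftedWeight-τ : ∀ t → 1 < c → suc c ≤ r → ∀ a → shiftedWeight c t (τ a) ≡
        (ρ r a ℚ.- α c a) ℚ.+ ((e 1 a ℚ.- e (suc c) a) ℚ.+ (e (sw t) a ℚ.- e (suc r) a))
      shiftedWeight-τ t 1<c c<r a = cong₂ ℚ._+_ (ρ-τ a) (cong₂ ℚ._+_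
        (trans (root-τ (1 , c) a) (cong₂ (λ i m → root {r} (i , m) a)
          (sw-other (ℕP.<⇒≢ 1<c) (ℕP.<⇒≢ (ℕP.m<n⇒m<1+n 1<c))) sw-x))
        (trans (root-τ (t , suc r) a) (cong (λ m → root {r} (sw t , m) a)
          (sw-other (ℕP.>⇒≢ (ℕP.m<n⇒m<1+n c<r)) (ℕP.>⇒≢ (s≤s c<r))))))

    module _ {t : ℕ} (1<c : 1 < c) (c<t : suc c < t) (t≤r : t ≤ r) where

      private
        fixed : shiftedWeight c t ∘ τ ≗ shiftedWeight c t
        fixed a = trans (shiftedWeight-τ t 1<c (ℕP.≤-trans (ℕP.<⇒≤ c<t) t≤r) a)
          (trans (cong (λ s → (ρ r a ℚ.- α c a) ℚ.+ ((e 1 a ℚ.- e (suc c) a) ℚ.+ (e s a ℚ.- e (suc r) a)))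
              (sw-other (ℕP.>⇒≢ (ℕP.<-trans ℕP.≤-refl c<t)) (ℕP.>⇒≢ c<t)))
            (solve 5 (λ p x y z w → (p :- (x :- y)) :+ ((z :- y) :+ w) := p :+ ((z :- x) :+ w)) refl
              (ρ r a) (e {r} c a) (e {r} (suc c) a) (e {r} 1 a) (root {r} (t , suc r) a)))

      straighten-zero : M (shiftedWeight c t) 0 ≡ 0ℤ
      straighten-zero = weylSum-fixed-zero v {shiftedWeight c t} fixed

      straighten-suc : ∀ k → M (shiftedWeight c t) (suc k) ≡ M (shiftedWeight (suc c) t) k
      straighten-suc k = trans (weylSum-fixed-suc v {shiftedWeight c t} fixed k)
        (weylSum-cong (roots r) v k λ a →
          solve 5 (λ p x y z w → (p :+ ((z :- x) :+ w)) :+ (x :- y) := p :+ ((z :- y) :+ w)) refl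
            (ρ r a) (e {r} c a) (e {r} (suc c) a) (e {r} 1 a) (root {r} (t , suc r) a))

    module _ (1<c : 1 < c) (c<r : suc c ≤ r) where

      private
        reflected : shiftedWeight c (suc c) ∘ τ ≗ v
        reflected a = begin
          shiftedWeight c (suc c) (τ a)  ≡⟨ shiftedWeight-τ (suc c) 1<c c<r a ⟩
          _ ≡⟨ cong (λ s → (ρ r a ℚ.- α c a) ℚ.+ ((e 1 a ℚ.- e (suc c) a) ℚ.+ (e s a ℚ.- e (suc r) a))) sw-y ⟩
          _ ≡⟨ solve 5 (λ p x y z w → (p :- (x :- y)) :+ ((z :- y) :+ (x :- w)) := (z :- w) :+ p) refl
                 (ρ r a) (e {r} c a) (e {r} (suc c) a) (e {r} 1 a) (e {r} (suc r) a) ⟩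
          root (1 , suc r) a ℚ.+ ρ r a   ≡⟨ cong (ℚ._+ ρ r a) (θ≗root r a) ⟨
          v a                            ∎

        shifted : shiftedWeight c (suc c) ⊕ α c ≗ v
        shifted a = trans
          (solve 5 (λ p x y z w → (p :+ ((z :- x) :+ (y :- w))) :+ (x :- y) := (z :- w) :+ p) refl
             (ρ r a) (e {r} c a) (e {r} (suc c) a) (e {r} 1 a) (e {r} (suc r) a))
          (cong (ℚ._+ ρ r a) (sym (θ≗root r a)))

        above : ∀ k → M (v ⊕ α c) k ≡ 0ℤ
        -- The vanishing required by the reflected recursion at y = v: the simple root α_c pairs
        -- positively with v, so v + α_c lies strictly above the whole orbit.
        above = weylSum-above (pairing-root (∈-rootIndices⁺ (s≤s z≤n) ℕP.≤-refl (ℕP.m≤n⇒m≤1+n c<r)))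

      weylSum-adjacent : ∀ k → M (shiftedWeight c (suc c)) k ≡ qj-qj-1 1 k
      weylSum-adjacent zero =
        trans (weylSum-reflected-zero v {shiftedWeight c (suc c)} reflected shifted) (cong ℤ.-_ weylSum-self-zero)
      weylSum-adjacent (suc k) =
        trans (weylSum-reflected-suc v {shiftedWeight c (suc c)} reflected shifted k (above k)) (value k)
        where
        value : ∀ k → ℤ.- M v (suc k) ℤ.+ M v k ≡ qj-qj-1 1 (suc k)
        value zero    = cong₂ (λ x y → ℤ.- x ℤ.+ y) (weylSum-self-suc 0) weylSum-self-zero
        value (suc k) = cong₂ (λ x y → ℤ.- x ℤ.+ y) (weylSum-self-suc (suc k)) (weylSum-self-suc k)

  simpleIndex : ∀ {p} → 1 < p → p ≤ r → ∃[ d ] p ≡ suc (toℕ {r} d)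
  simpleIndex {suc p} _ p<r = fromℕ< p<r , cong suc (sym (FP.toℕ-fromℕ< p<r))

  weylSum-shiftedWeight : ∀ j {p} → 1 < p → suc j + p ≤ r → ∀ k →
    M (shiftedWeight p (suc j + p)) k ≡ qj-qj-1 (suc j) k
  weylSum-shiftedWeight j {p} 1<p t≤r k with d , refl ← simpleIndex 1<p (ℕP.≤-trans (ℕP.m≤n+m p (suc j)) t≤r) = go j t≤r k
    where
    go : ∀ j → suc j + p ≤ r → ∀ k → M (shiftedWeight p (suc j + p)) k ≡ qj-qj-1 (suc j) k
    go zero    t≤r k       = weylSum-adjacent d 1<p t≤r k
    -- In degree zero a fixed weight gives 0, which is also the constant coefficient of the target
    -- because its exponents j + 2 and j + 1 are both positive.
    go (suc j) t≤r zero    = straighten-zero d 1<p (s≤s (s≤s (ℕP.m≤n+m p j))) t≤r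
    go (suc j) t≤r (suc k) = trans (straighten-suc d 1<p (s≤s (s≤s (ℕP.m≤n+m p j))) t≤r k)
      -- The right end t does not move. Only its expression as gap plus start changes, from (j + 2)
      -- + p to (j + 1) + (p + 1); lowering both indices of the target coefficient by one is
      -- definitional.
      (trans (cong (λ t → M (shiftedWeight (suc p) t) k) (sym (ℕP.+-suc (suc j) p)))
        (weylSum-shiftedWeight j (ℕP.m<n⇒m<1+n 1<p) (subst (_≤ r) (sym (ℕP.+-suc (suc j) p)) t≤r) k))

-- Since α_{1,i} = e_1 - e_{i+1}, the parameter p is i + 1; subtracting ρ and then μ is subtracting
-- the single weight ρ + μ.
mq-θ : ∀ {r i t} → t ≤ suc r → ∀ k →
  mq r (θ r) (αr 1 i ⊕ αr t r) k ≡ weylSum (roots r) (θ r ⊕ ρ r) (shiftedWeight (suc i) t) k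
mq-θ {r} {i} {t} t≤ k = ∑-cong
  {f = λ σ → sgn (len σ) ℤ.* ℤ.+ ℘q r (act σ (θ r ⊕ ρ r) ⊖ ρ r ⊖ (αr 1 i ⊕ αr t r)) k}
  {weylTerm (roots r) (θ r ⊕ ρ r) (shiftedWeight (suc i) t) k}
  (λ σ → cong (λ w → sgn (len σ) ℤ.* ℤ.+ w) (ways-cong (posRoots≋ r) k λ a →
    trans (⊖-⊕ (act σ (θ r ⊕ ρ r)) (ρ r) (αr 1 i ⊕ αr t r) a)
      (⊖-cong {x = act σ (θ r ⊕ ρ r)} (λ _ → refl)
        (⊕-cong {x = ρ r} (λ _ → refl) (⊕-cong (αr≗root {r} (s≤s z≤n)) (αr≗root {r} t≤))) a)))
  (Weyl r)

theorem1p4 : (r : ℕ) → 3 ≤ r → (i : ℕ) → 1 ≤ i → i ≤ r ∸ 2 →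
    (j : ℕ) → 1 ≤ j → j ≤ r ∸ i ∸ 1 →
    (k : ℕ) → mq r (θ r) (αr 1 i ⊕ αr (i + j + 1) r) k ≡ qj-qj-1 j k
theorem1p4 r _ i 1≤i _ (suc j) _ j≤ k = begin
  mq r (θ r) (αr 1 i ⊕ αr (i + suc j + 1) r) k
    ≡⟨ cong (λ t → mq r (θ r) (αr 1 i ⊕ αr t r) k) t≡ ⟩
  mq r (θ r) (αr 1 i ⊕ αr (suc j + suc i) r) k              ≡⟨ mq-θ {i = i} (ℕP.m≤n⇒m≤1+n t≤r) k ⟩
  weylSum (roots r) (θ r ⊕ ρ r) (shiftedWeight (suc i) (suc j + suc i)) k
    ≡⟨ weylSum-shiftedWeight j (s≤s 1≤i) t≤r k ⟩
  qj-qj-1 (suc j) k ∎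
  where
  t≡ : i + suc j + 1 ≡ suc j + suc i
  t≡ = trans (ℕP.+-assoc i (suc j) 1) (trans (ℕP.+-comm i (suc j + 1)) (ℕP.+-assoc (suc j) 1 i))
  t≤r : suc j + suc i ≤ r
  -- If r < t, then r ≤ i + 1 + j for the predecessor `j` of the given exponent, so r ∸ i ∸ 1 ≤ j
  -- even with truncated subtraction. This contradicts the assumed bound on j + 1.
  t≤r = ℕP.≮⇒≥ λ r<t → ℕP.<⇒≱ (ℕP.n<1+n j) (ℕP.≤-trans j≤ (subst (_≤ j) (sym (ℕP.∸-+-assoc r i 1))
    (ℕP.m≤n+o⇒m∸n≤o r (i + 1) (ℕP.≤-pred (subst (suc r ≤_) (trans (sym t≡) (shape i j)) r<t)))))
    where
    shape : ∀ i j → i + suc j + 1 ≡ suc (i + 1 + j)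
    shape i j = ℕSolver.+-*-Solver.solve 2 (λ x y → x :+ (con 1 :+ y) :+ con 1 := con 1 :+ (x :+ con 1 :+ y)) refl i j
      where open ℕSolver.+-*-Solver using (_:+_; _:=_; con)
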